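{- Let $\Phi$ be a finite irreducible crystallographic root system with simple system $\Pi$, let $S\subseteq\Pi$ and $\beta\in\Phi^+$ with $S\cap\mathrm{Supp}(\beta)\ne\emptyset$. (1) The set $\Phi_{S,\beta}$ contains only short roots if and only if $\min\Phi_{S,\beta}$ is short. (2) The set $\Phi_{S,\beta}$ contains only long roots if and only if $\min\Phi_{S,\beta}$ is long and the connected component of $\min\Phi_{S,\beta}$ in the Dynkin diagram of $(\Pi\setminus S)\cup\{\min\Phi_{S,\beta}\}$ contains only long simple roots. (3) The set $\Phi_{S,\beta}$ contains both long and short roots if and only if $\min\Phi_{S,\beta}$ is long and the connected component of $\min\Phi_{S,\beta}$ in the Dynkin diagram of $(\Pi\setminus S)\cup\{\min\Phi_{S,\beta}\}$ contains some short simple root.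
   Context: $\Phi$ is reduced, in a Euclidean space with Weyl-group-invariant form; $\Phi^+$ is the set of positive roots with respect to $\Pi$. Each root $\gamma$ is written $\gamma=\sum_{\alpha\in\Pi}c_\alpha(\gamma)\alpha$; $\mathrm{Supp}(\gamma)=\{\alpha\in\Pi:c_\alpha(\gamma)\ne0\}$. Define $\Phi_{S,\beta}=\{\gamma\in\Phi:c_\alpha(\gamma)=c_\alpha(\beta)\ \forall\alpha\in S\}$ and $\Phi_{S,\mathbb Z\beta}=\{\gamma\in\Phi:\exists k\in\mathbb Z\text{ with }c_\alpha(\gamma)=k\,c_\alpha(\beta)\ \forall\alpha\in S\}$. When $\beta\in\Phi^+$ and $\mathrm{Supp}(\beta)\cap S\ne\emptyset$, $\Phi_{S,\beta}$ has a minimum in the root poset ($\Phi^+$ ordered by $\alpha\le\beta$ iff $\beta-\alpha$ is a nonnegative linear combination of positive roots), and $(\Pi\setminus S)\cup\{\min\Phi_{S,\beta}\}$ is a simple system of the root subsystem $\Phi_{S,\mathbb Z\beta}$; "simple roots" in (2), (3) refers to this simple system. Long and short are meant relative to $\Phi$; in simply laced $\Phi$ all roots are considered long. -}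

module Defs where

open import Algebra.Bundles using (CommutativeRing)
open import Algebra.Module.Bundles using (LeftModule)
import Algebra.Definitions.RawMonoid as RawMonoidDefs
open import Data.Fin.Base using (Fin)
open import Data.Fin.Subset using (Subset; Nonempty; ∁; _∈_; _∉_)
open import Data.Integer.Base as ℤ using (ℤ; +_; -[1+_]; 0ℤ)
open import Data.Nat.Base using (ℕ; suc)
open import Data.Product.Base using (_×_; ∃; ∃-syntax)
open import Data.Sum.Base using (_⊎_)
open import Level using (0ℓ; _⊔_) renaming (suc to lsuc)
open import Relation.Binary.Construct.Closure.ReflexiveTransitive using (Star)
open import Relation.Binary.Core using (Rel)
open import Relation.Binary.PropositionalEquality.Core using (_≡_; _≢_)
open import Relation.Binary.Structures using (IsStrictTotalOrder)
open import Relation.Nullary.Negation using (¬_)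
open import Relation.Unary using (Pred)

-- The scalars. The classical real numbers are an instance; no completeness
-- or Archimedean property is assumed.

record OrderedField c ℓ₁ ℓ₂ : Set (lsuc (c ⊔ ℓ₁ ⊔ ℓ₂)) where
  infix 4 _<_ _≤_
  field
    commutativeRing : CommutativeRing c ℓ₁

  open CommutativeRing commutativeRing public

  field
    _<_                : Rel Carrier ℓ₂
    isStrictTotalOrder : IsStrictTotalOrder _≈_ _<_
    0<1                : 0# < 1#
    +-monoˡ-<          : ∀ {x y} z → x < y → x + z < y + z
    *-pos              : ∀ {x y} → 0# < x → 0# < y → 0# < x * y
    inverse            : ∀ x → ¬ (x ≈ 0#) → ∃[ y ] x * y ≈ 1#

  _≤_ : Rel Carrier (ℓ₁ ⊔ ℓ₂)
  x ≤ y = x < y ⊎ x ≈ y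

  private module Mult = RawMonoidDefs +-rawMonoid

  fromℤ : ℤ → Carrier
  fromℤ (+ n)    = n Mult.× 1#
  fromℤ -[1+ n ] = - (suc n Mult.× 1#)

-- Finite dimensionality is not a field: it follows from `spanning` in
-- RootSystem below.

record EuclideanSpace {c ℓ₁ ℓ₂} (K : OrderedField c ℓ₁ ℓ₂) m ℓm
       : Set (c ⊔ ℓ₁ ⊔ ℓ₂ ⊔ lsuc (m ⊔ ℓm)) where
  open OrderedField K
  field
    leftModule : LeftModule ring m ℓm

  open LeftModule leftModule public

  field
    ⟨_,_⟩         : Carrierᴹ → Carrierᴹ → Carrier
    ⟨⟩-cong       : ∀ {u u′ v v′} → u ≈ᴹ u′ → v ≈ᴹ v′ → ⟨ u , v ⟩ ≈ ⟨ u′ , v′ ⟩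
    ⟨⟩-sym        : ∀ u v → ⟨ u , v ⟩ ≈ ⟨ v , u ⟩
    ⟨⟩-additive   : ∀ u v w → ⟨ u +ᴹ v , w ⟩ ≈ ⟨ u , w ⟩ + ⟨ v , w ⟩
    ⟨⟩-homogenous : ∀ k u v → ⟨ k *ₗ u , v ⟩ ≈ k * ⟨ u , v ⟩
    ⟨⟩-nonneg     : ∀ v → 0# ≤ ⟨ v , v ⟩
    ⟨⟩-definite   : ∀ v → ⟨ v , v ⟩ ≈ 0# → v ≈ᴹ 0ᴹ

  combination : ∀ {n} → (Fin n → Carrier) → (Fin n → Carrierᴹ) → Carrierᴹ
  combination k v = RawMonoidDefs.sum +ᴹ-rawMonoid (λ i → k i *ₗ v i)

-- A finite reduced crystallographic root system; its roots are enumerated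
-- without repetition and are referred to by their indices in Fin size.
-- The form on E is invariant under the Weyl group because the reflections
-- in `reflection` are orthogonal for it.

record RootSystem {c ℓ₁ ℓ₂ m ℓm} {K : OrderedField c ℓ₁ ℓ₂}
                  (E : EuclideanSpace K m ℓm)
       : Set (c ⊔ ℓ₁ ⊔ ℓ₂ ⊔ m ⊔ ℓm) where
  open OrderedField K
  open EuclideanSpace E
  field
    size       : ℕ
    root       : Fin size → Carrierᴹ
    distinct   : ∀ i j → root i ≈ᴹ root j → i ≡ j
    nonzero    : ∀ i → ¬ (root i ≈ᴹ 0ᴹ)
    spanning   : ∀ v → ∃[ k ] v ≈ᴹ combination k root
    -- cartan i j is the number 2⟨i,j⟩ / ⟨j,j⟩, required to be an integer.
    cartan     : Fin size → Fin size → ℤ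
    integral   : ∀ i j → (1# + 1#) * ⟨ root i , root j ⟩
                         ≈ fromℤ (cartan i j) * ⟨ root j , root j ⟩
    reflection : ∀ i j → ∃[ l ]
                   root l ≈ᴹ root i +ᴹ -ᴹ (fromℤ (cartan i j) *ₗ root j)
    reduced    : ∀ i j k → root j ≈ᴹ k *ₗ root i →
                   (root j ≈ᴹ root i) ⊎ (root j ≈ᴹ -ᴹ root i)

  Root : Set
  Root = Fin size

  Irreducible : Set ℓ₁
  Irreducible = ¬ (∃[ P ] Nonempty P × Nonempty (∁ P) ×
                     (∀ (i j : Root) → i ∈ P → j ∉ P →
                        ⟨ root i , root j ⟩ ≈ 0#))

  normSq : Root → Carrier
  normSq i = ⟨ root i , root i ⟩

  -- Long means of maximal length, so that every root is long when all
  -- lengths agree; an irreducible system has at most two root lengths, and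
  -- short means of the smaller one.
  Long : Pred Root (ℓ₁ ⊔ ℓ₂)
  Long i = ∀ j → normSq j ≤ normSq i

  Short : Pred Root ℓ₂
  Short i = ∃[ j ] normSq i < normSq j

  -- The number of edges joining i and j in a Dynkin diagram.
  bonds : Root → Root → ℤ
  bonds i j = cartan i j ℤ.* cartan j i

  Adjacent : Pred Root 0ℓ → Rel Root 0ℓ
  Adjacent D i j = D i × D j × i ≢ j × bonds i j ≢ 0ℤ

  -- InComponent D i j: j lies in the connected component of i (a vertex)
  -- in the Dynkin diagram with vertex set D.
  InComponent : Pred Root 0ℓ → Root → Pred Root 0ℓ
  InComponent D = Star (Adjacent D)

-- A simple system (base): a linearly independent family of roots over which
-- every root has integer coefficients of one sign. The coefficients are data
-- here, but linear independence makes them unique.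

record SimpleSystem {c ℓ₁ ℓ₂ m ℓm} {K : OrderedField c ℓ₁ ℓ₂}
                    {E : EuclideanSpace K m ℓm} (Φ : RootSystem E)
       : Set (c ⊔ ℓ₁ ⊔ ℓ₂ ⊔ m ⊔ ℓm) where
  open OrderedField K
  open EuclideanSpace E
  open RootSystem Φ
  infix 4 _≼_
  field
    rank        : ℕ
    simple      : Fin rank → Root
    independent : ∀ k → combination k (λ a → root (simple a)) ≈ᴹ 0ᴹ →
                    ∀ a → k a ≈ 0#
    coeff       : Root → Fin rank → ℤ
    expansion   : ∀ γ → root γ ≈ᴹ combination (λ a → fromℤ (coeff γ a))
                                              (λ a → root (simple a))
    oneSigned   : ∀ γ → (∀ a → 0ℤ ℤ.≤ coeff γ a) ⊎ (∀ a → coeff γ a ℤ.≤ 0ℤ)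

  Positive : Pred Root 0ℓ
  Positive γ = ∀ a → 0ℤ ℤ.≤ coeff γ a

  Supp : Root → Pred (Fin rank) 0ℓ
  Supp γ a = coeff γ a ≢ 0ℤ

  -- The order of the root poset: δ − γ is a nonnegative linear combination
  -- of positive roots (the scalars vanish off the positive roots).
  _≼_ : Rel Root (c ⊔ ℓ₁ ⊔ ℓ₂ ⊔ ℓm)
  γ ≼ δ = ∃[ k ] (∀ i → 0# ≤ k i) × (∀ i → ¬ Positive i → k i ≈ 0#) ×
                 (root δ +ᴹ -ᴹ root γ ≈ᴹ combination k root)

  IsMinimum : Pred Root 0ℓ → Pred Root (c ⊔ ℓ₁ ⊔ ℓ₂ ⊔ ℓm)
  IsMinimum P μ = P μ × (∀ γ → P γ → μ ≼ γ)

  -- The set Φ_{S,β}, for a set S of simple roots.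
  Φ[_,_] : Subset rank → Root → Pred Root 0ℓ
  Φ[ S , β ] γ = ∀ a → a ∈ S → coeff γ a ≡ coeff β a

  -- (Π ∖ S) ∪ {μ}
  [Π∖_]∪⁅_⁆ : Subset rank → Root → Pred Root 0ℓ
  [Π∖ S ]∪⁅ μ ⁆ γ = (∃[ a ] a ∉ S × γ ≡ simple a) ⊎ γ ≡ μ

{-# OPTIONS --safe #-}
-- Γ := Φ[ S , β ]. Every γ in Γ is μ plus a nonnegative combination of Π∖S. Reflecting
-- γ in simple roots outside S lowers it inside Γ without changing its length, until
-- ⟨γ,a⟩ ≤ 0 for all a in Π∖S; then ⟨γ,γ⟩ ≤ ⟨γ,μ⟩. So ‖γ‖ ≤ ‖μ‖, and μ is long as soon as
-- some γ in Γ is. If μ is long and the lowered γ is short, γ − μ is a short root in the span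
-- of Π∖S, not orthogonal to μ; reflecting it down in turn to a short simple root stays
-- in the component of μ. Conversely, along a path from μ to a short simple root, the
-- neighbours can be added to the support of an element of Γ one at a time, by
-- reflections while they are long, and the first short one yields a short element of Γ.
module Submission where

open import Defs
open import Algebra.Solver.Ring.AlmostCommutativeRing
  using (fromCommutativeRing; _-Raw-AlmostCommutative⟶_)
import Algebra.Properties.CommutativeMonoid.Sum as CommutativeMonoidSum
import Algebra.Properties.Group as GroupProperties
import Algebra.Properties.Ring as RingProperties
import Algebra.Properties.Semiring.Mult as SemiringMult
import Algebra.Solver.Ring as RingSolver
open import Data.Fin.Base using (Fin; zero; suc)
open import Data.Fin.Properties using (any?; all?; _≟_; suc-injective)
open import Data.Fin.Subset using (Subset; _∈_; _∉_)
open import Data.Fin.Subset.Properties using (_∈?_)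
open import Data.Integer.Base as ℤ using (ℤ; +_; -[1+_]; 0ℤ; 1ℤ; -1ℤ)
import Data.Integer.Properties as ℤ
import Data.Integer.Tactic.RingSolver as ℤ-RingSolver
import Data.Maybe.Base as Maybe
open import Data.Nat.Base as ℕ using (ℕ; zero; suc)
open import Data.Nat.Induction using (<-wellFounded)
import Data.Nat.Properties as ℕ
open import Data.Product.Base using (_×_; _,_; proj₁; proj₂; ∃-syntax)
open import Data.Sum.Base using (_⊎_; inj₁; inj₂; [_,_]′)
open import Data.Vec.Functional using (Vector)
open import Function.Base using (_∘_; id)
open import Function.Bundles using (_⇔_; mk⇔)
open import Induction.WellFounded using (Acc; acc)
open import Level using (0ℓ)
open import Relation.Binary.Bundles using (StrictTotalOrder)
open import Relation.Binary.Construct.Closure.ReflexiveTransitive using (ε; _◅_)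
open import Relation.Binary.Definitions using (tri<; tri≈; tri>)
import Relation.Binary.Properties.StrictTotalOrder as StrictTotalOrderProperties
import Relation.Binary.Reasoning.StrictPartialOrder as StrictPartialOrderReasoning
import Relation.Binary.Reasoning.Setoid as SetoidReasoning
open import Relation.Binary.PropositionalEquality as ≡ using (_≡_; _≢_; refl; cong; cong₂; subst)
open import Relation.Unary using (Pred)
open import Relation.Nullary using (¬_; yes; no; contradiction)
open import Relation.Nullary.Decidable using (_×-dec_; ¬?; dec⇒maybe; decidable-stable)

module OrderedFieldProperties {c ℓ₁ ℓ₂} (K : OrderedField c ℓ₁ ℓ₂) where
  open OrderedField K hiding (refl; sym; trans; zero)
  private module ≈ = OrderedField K using (refl; sym; trans; reflexive)
  open RingProperties ring
    using (-‿involutive; -‿distribˡ-*; -‿distribʳ-*; -‿+-comm)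
  open RingProperties ring public using (-0#≈0#)
  open SemiringMult semiring using (×-homo-+; ×1-homo-*) renaming (_×_ to _·_)
  open CommutativeMonoidSum +-commutativeMonoid public
    using (sum; sum-cong-≋; ∑-distrib-+)

  strictTotalOrder : StrictTotalOrder c ℓ₁ ℓ₂
  strictTotalOrder = record { isStrictTotalOrder = isStrictTotalOrder }

  module < = StrictTotalOrder strictTotalOrder
  module ≤ = StrictTotalOrderProperties strictTotalOrder
  module ≤-Reasoning = StrictPartialOrderReasoning <.strictPartialOrder

  fromℤ-⊖ : ∀ m n → fromℤ (m ℤ.⊖ n) ≈ m · 1# + - (n · 1#)
  fromℤ-⊖ m zero = ≈.trans (≈.sym (+-identityʳ _)) (+-congˡ (≈.sym -0#≈0#))
  fromℤ-⊖ zero (suc n) = ≈.sym (+-identityˡ _)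
  fromℤ-⊖ (suc m) (suc n) = begin
    fromℤ (suc m ℤ.⊖ suc n)                    ≡⟨ cong fromℤ (ℤ.[1+m]⊖[1+n]≡m⊖n m n) ⟩
    fromℤ (m ℤ.⊖ n)                            ≈⟨ fromℤ-⊖ m n ⟩
    m · 1# + - (n · 1#)                        ≈⟨ +-congʳ (+-identityʳ _) ⟨
    m · 1# + 0# + - (n · 1#)                   ≈⟨ +-congʳ (+-congˡ (-‿inverseʳ 1#)) ⟨
    m · 1# + (1# + - 1#) + - (n · 1#)          ≈⟨ +-congʳ (+-assoc _ _ _) ⟨
    m · 1# + 1# + - 1# + - (n · 1#)            ≈⟨ +-assoc _ _ _ ⟩
    (m · 1# + 1#) + (- 1# + - (n · 1#))        ≈⟨ +-cong (+-comm _ _) (-‿+-comm _ _) ⟩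
    suc m · 1# + - (suc n · 1#)                ∎
    where open SetoidReasoning setoid

  fromℤ-neg : ∀ i → fromℤ (ℤ.- i) ≈ - fromℤ i
  fromℤ-neg (+ zero)  = ≈.sym -0#≈0#
  fromℤ-neg (+ suc n) = ≈.refl
  fromℤ-neg -[1+ n ]  = ≈.sym (-‿involutive _)

  fromℤ-+ : ∀ i j → fromℤ (i ℤ.+ j) ≈ fromℤ i + fromℤ j
  fromℤ-+ (+ m)    (+ n)    = ×-homo-+ 1# m n
  fromℤ-+ (+ m)    -[1+ n ] = fromℤ-⊖ m (suc n)
  fromℤ-+ -[1+ m ] (+ n)    = ≈.trans (fromℤ-⊖ n (suc m)) (+-comm _ _)
  fromℤ-+ -[1+ m ] -[1+ n ] = begin
    - (suc (suc (m ℕ.+ n)) · 1#)       ≡⟨ cong (λ k → - (suc k · 1#)) (≡.sym (ℕ.+-suc m n)) ⟩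
    - ((suc m ℕ.+ suc n) · 1#)         ≈⟨ -‿cong (×-homo-+ 1# (suc m) (suc n)) ⟩
    - (suc m · 1# + suc n · 1#)        ≈⟨ -‿+-comm _ _ ⟨
    - (suc m · 1#) + - (suc n · 1#)    ∎
    where open SetoidReasoning setoid

  private
    fromℤ-*⁺ : ∀ m j → fromℤ (+ m ℤ.* j) ≈ fromℤ (+ m) * fromℤ j
    fromℤ-*⁺ m (+ n) = ≈.trans (≈.reflexive (cong fromℤ (≡.sym (ℤ.pos-* m n)))) (×1-homo-* m n)
    fromℤ-*⁺ m -[1+ n ] = begin
      fromℤ (+ m ℤ.* -[1+ n ])         ≡⟨ cong fromℤ (ℤ.neg-distribʳ-* (+ m) (+ suc n)) ⟨
      fromℤ (ℤ.- (+ m ℤ.* + suc n))    ≈⟨ fromℤ-neg (+ m ℤ.* + suc n) ⟩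
      - fromℤ (+ m ℤ.* + suc n)        ≈⟨ -‿cong (fromℤ-*⁺ m (+ suc n)) ⟩
      - (fromℤ (+ m) * fromℤ (+ suc n)) ≈⟨ -‿distribʳ-* _ _ ⟩
      fromℤ (+ m) * fromℤ -[1+ n ]     ∎
      where open SetoidReasoning setoid

  fromℤ-* : ∀ i j → fromℤ (i ℤ.* j) ≈ fromℤ i * fromℤ j
  fromℤ-* (+ m)    j = fromℤ-*⁺ m j
  fromℤ-* -[1+ m ] j = begin
    fromℤ (-[1+ m ] ℤ.* j)         ≡⟨ cong fromℤ (ℤ.neg-distribˡ-* (+ suc m) j) ⟨
    fromℤ (ℤ.- (+ suc m ℤ.* j))    ≈⟨ fromℤ-neg (+ suc m ℤ.* j) ⟩
    - fromℤ (+ suc m ℤ.* j)        ≈⟨ -‿cong (fromℤ-*⁺ (suc m) j) ⟩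
    - (fromℤ (+ suc m) * fromℤ j)  ≈⟨ -‿distribˡ-* _ _ ⟩
    fromℤ -[1+ m ] * fromℤ j       ∎
    where open SetoidReasoning setoid

  fromℤ-1 : fromℤ 1ℤ ≈ 1#
  fromℤ-1 = +-identityʳ 1#

  fromℤ-morphism : ℤ.+-*-rawRing -Raw-AlmostCommutative⟶ fromCommutativeRing commutativeRing
  fromℤ-morphism = record
    { ⟦_⟧    = fromℤ
    ; +-homo = fromℤ-+
    ; *-homo = fromℤ-*
    ; -‿homo = fromℤ-neg
    ; 0-homo = ≈.refl
    ; 1-homo = fromℤ-1
    }

  module Solver = RingSolver ℤ.+-*-rawRing (fromCommutativeRing commutativeRing) fromℤ-morphism
    (λ i j → Maybe.map (≈.reflexive ∘ cong fromℤ) (dec⇒maybe (i ℤ.≟ j)))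
  open Solver using (solve; _:=_; _:+_; _:*_; :-_; _:-_; con)

  ≮⇒≥ : ∀ {x y} → ¬ (x < y) → y ≤ x
  ≮⇒≥ {x} {y} x≮y with <.compare x y
  ... | tri< x<y _ _ = contradiction x<y x≮y
  ... | tri≈ _ x≈y _ = inj₂ (≈.sym x≈y)
  ... | tri> _ _ y<x = inj₁ y<x

  ≰⇒> : ∀ {x y} → ¬ (x ≤ y) → y < x
  ≰⇒> {x} {y} x≰y with <.compare x y
  ... | tri< x<y _ _ = contradiction (inj₁ x<y) x≰y
  ... | tri≈ _ x≈y _ = contradiction (inj₂ x≈y) x≰y
  ... | tri> _ _ y<x = y<x

  <⇒≱ : ∀ {x y} → x < y → ¬ (y ≤ x)
  <⇒≱ x<y (inj₁ y<x) = <.asym x<y y<x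
  <⇒≱ x<y (inj₂ y≈x) = <.irrefl (≈.sym y≈x) x<y

  +-monoˡ-≤ : ∀ {x y} z → x ≤ y → x + z ≤ y + z
  +-monoˡ-≤ z (inj₁ x<y) = inj₁ (+-monoˡ-< z x<y)
  +-monoˡ-≤ z (inj₂ x≈y) = inj₂ (+-congʳ x≈y)

  +-monoʳ-< : ∀ {x y} z → x < y → z + x < z + y
  +-monoʳ-< {x} {y} z x<y = begin-strict
    z + x ≈⟨ +-comm z x ⟩
    x + z <⟨ +-monoˡ-< z x<y ⟩
    y + z ≈⟨ +-comm y z ⟩
    z + y ∎
    where open ≤-Reasoning

  +-mono-≤ : ∀ {x y u v} → x ≤ y → u ≤ v → x + u ≤ y + v
  +-mono-≤ {x} {y} {u} {v} x≤y u≤v = begin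
    x + u ≤⟨ +-monoˡ-≤ u x≤y ⟩
    y + u ≈⟨ +-comm y u ⟩
    u + y ≤⟨ +-monoˡ-≤ y u≤v ⟩
    v + y ≈⟨ +-comm v y ⟩
    y + v ∎
    where open ≤-Reasoning

  neg-mono-≤ : ∀ {x y} → x ≤ y → - y ≤ - x
  neg-mono-≤ {x} {y} x≤y = begin
    - y               ≈⟨ solve 2 (λ x y → :- y := x :+ (:- x :- y)) ≈.refl x y ⟩
    x + (- x - y)     ≤⟨ +-monoˡ-≤ (- x - y) x≤y ⟩
    y + (- x - y)     ≈⟨ solve 2 (λ x y → y :+ (:- x :- y) := :- x) ≈.refl x y ⟩
    - x               ∎
    where open ≤-Reasoning

  neg-mono-< : ∀ {x y} → x < y → - y < - x
  neg-mono-< {x} {y} x<y = begin-strict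
    - y               ≈⟨ solve 2 (λ x y → :- y := x :+ (:- x :- y)) ≈.refl x y ⟩
    x + (- x - y)     <⟨ +-monoˡ-< (- x - y) x<y ⟩
    y + (- x - y)     ≈⟨ solve 2 (λ x y → y :+ (:- x :- y) := :- x) ≈.refl x y ⟩
    - x               ∎
    where open ≤-Reasoning

  *-nonneg : ∀ {x y} → 0# ≤ x → 0# ≤ y → 0# ≤ x * y
  *-nonneg (inj₁ 0<x) (inj₁ 0<y) = inj₁ (*-pos 0<x 0<y)
  *-nonneg {x} (inj₁ _) (inj₂ 0≈y) = inj₂ (≈.trans (≈.sym (zeroʳ x)) (*-congˡ 0≈y))
  *-nonneg {y = y} (inj₂ 0≈x) _ = inj₂ (≈.trans (≈.sym (zeroˡ y)) (*-congʳ 0≈x))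

  *-monoˡ-≤ : ∀ {x y z} → 0# ≤ x → y ≤ z → x * y ≤ x * z
  *-monoˡ-≤ {x} {y} {z} 0≤x y≤z = begin
    x * y                 ≈⟨ +-identityˡ _ ⟨
    0# + x * y            ≤⟨ +-monoˡ-≤ (x * y) (*-nonneg 0≤x 0≤z-y) ⟩
    x * (z - y) + x * y   ≈⟨ solve 3 (λ x y z → x :* (z :- y) :+ x :* y := x :* z) ≈.refl x y z ⟩
    x * z                 ∎
    where
    open ≤-Reasoning
    0≤z-y : 0# ≤ z - y
    0≤z-y = begin
      0#    ≈⟨ -‿inverseʳ y ⟨
      y - y ≤⟨ +-monoˡ-≤ (- y) y≤z ⟩
      z - y ∎

  *-nonneg-nonpos : ∀ {x y} → 0# ≤ x → y ≤ 0# → x * y ≤ 0#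
  *-nonneg-nonpos {x} 0≤x y≤0 = ≤.trans (*-monoˡ-≤ 0≤x y≤0) (inj₂ (zeroʳ x))

  *-pos-neg : ∀ {x y} → 0# < x → y < 0# → x * y < 0#
  *-pos-neg {x} {y} 0<x y<0 = begin-strict
    x * y        ≈⟨ solve 2 (λ x y → x :* y := :- (x :* :- y)) ≈.refl x y ⟩
    - (x * - y)  <⟨ neg-mono-< (*-pos 0<x (<.<-respˡ-≈ -0#≈0# (neg-mono-< y<0))) ⟩
    - 0#         ≈⟨ -0#≈0# ⟩
    0#           ∎
    where open ≤-Reasoning

  double-pos : ∀ {x} → 0# < x → 0# < x + x
  double-pos {x} 0<x = begin-strict
    0#       <⟨ 0<x ⟩
    x        ≈⟨ +-identityʳ x ⟨
    x + 0#   <⟨ +-monoʳ-< x 0<x ⟩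
    x + x    ∎
    where open ≤-Reasoning

  double-neg : ∀ {x} → x < 0# → x + x < 0#
  double-neg {x} x<0 = begin-strict
    x + x    <⟨ +-monoʳ-< x x<0 ⟩
    x + 0#   ≈⟨ +-identityʳ x ⟩
    x        <⟨ x<0 ⟩
    0#       ∎
    where open ≤-Reasoning

  nonneg∧≢0⇒pos : ∀ {x} → 0# ≤ x → ¬ (x ≈ 0#) → 0# < x
  nonneg∧≢0⇒pos (inj₁ 0<x) _   = 0<x
  nonneg∧≢0⇒pos (inj₂ 0≈x) x≉0 = contradiction (≈.sym 0≈x) x≉0

  *-pos⁻ : ∀ {x y} → 0# ≤ x → 0# < x * y → 0# < x × 0# < y
  *-pos⁻ {x} {y} 0≤x 0<xy =
    nonneg∧≢0⇒pos 0≤x (λ x≈0 → <.irrefl (≈.sym (≈.trans (*-congʳ x≈0) (zeroˡ y))) 0<xy) ,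
    ≰⇒> (λ y≤0 → <⇒≱ 0<xy (*-nonneg-nonpos 0≤x y≤0))

  *-neg⁻ : ∀ {x y} → 0# ≤ x → x * y < 0# → 0# < x × y < 0#
  *-neg⁻ {x} {y} 0≤x xy<0 =
    nonneg∧≢0⇒pos 0≤x (λ x≈0 → <.irrefl (≈.trans (*-congʳ x≈0) (zeroˡ y)) xy<0) ,
    ≰⇒> (λ 0≤y → <⇒≱ xy<0 (*-nonneg 0≤x 0≤y))

  fromℤ-nonneg : ∀ n → 0# ≤ fromℤ (+ n)
  fromℤ-nonneg zero    = ≤.refl
  fromℤ-nonneg (suc n) = begin
    0#                  ≈⟨ +-identityˡ 0# ⟨
    0# + 0#             ≤⟨ +-mono-≤ (inj₁ 0<1) (fromℤ-nonneg n) ⟩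
    1# + fromℤ (+ n)    ∎
    where open ≤-Reasoning

  fromℤ-mono-≤ : ∀ {i j} → i ℤ.≤ j → fromℤ i ≤ fromℤ j
  fromℤ-mono-≤ {i} {j} i≤j = begin
    fromℤ i                        ≈⟨ +-identityˡ _ ⟨
    0# + fromℤ i                   ≤⟨ +-monoˡ-≤ (fromℤ i) (fromℤ-nonneg ℤ.∣ j ℤ.- i ∣) ⟩
    fromℤ (+ ℤ.∣ j ℤ.- i ∣) + fromℤ i
      ≡⟨ cong (λ k → fromℤ k + fromℤ i) (ℤ.0≤i⇒+∣i∣≡i (ℤ.i≤j⇒0≤j-i i≤j)) ⟩
    fromℤ (j ℤ.- i) + fromℤ i      ≈⟨ fromℤ-+ (j ℤ.- i) i ⟨
    fromℤ (j ℤ.- i ℤ.+ i)          ≡⟨ cong fromℤ (j-i+i≡j i j) ⟩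
    fromℤ j                        ∎
    where
    open ≤-Reasoning
    j-i+i≡j : ∀ i j → j ℤ.- i ℤ.+ i ≡ j
    j-i+i≡j = ℤ-RingSolver.solve-∀

  fromℤ-mono-< : ∀ {i j} → i ℤ.< j → fromℤ i < fromℤ j
  fromℤ-mono-< {i} {j} i<j = begin-strict
    fromℤ i              ≈⟨ +-identityˡ _ ⟨
    0# + fromℤ i         <⟨ +-monoˡ-< (fromℤ i) 0<1 ⟩
    1# + fromℤ i         ≈⟨ +-congʳ fromℤ-1 ⟨
    fromℤ 1ℤ + fromℤ i   ≈⟨ fromℤ-+ 1ℤ i ⟨
    fromℤ (ℤ.suc i)      ≤⟨ fromℤ-mono-≤ (ℤ.i<j⇒suc[i]≤j i<j) ⟩
    fromℤ j              ∎
    where open ≤-Reasoning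

  fromℤ-cancel-≤ : ∀ {i j} → fromℤ i ≤ fromℤ j → i ℤ.≤ j
  fromℤ-cancel-≤ fi≤fj = ℤ.≮⇒≥ (λ j<i → <⇒≱ (fromℤ-mono-< j<i) fi≤fj)

  fromℤ-cancel-< : ∀ {i j} → fromℤ i < fromℤ j → i ℤ.< j
  fromℤ-cancel-< fi<fj = ℤ.≰⇒> (λ j≤i → <⇒≱ fi<fj (fromℤ-mono-≤ j≤i))

  fromℤ-injective : ∀ {i j} → fromℤ i ≈ fromℤ j → i ≡ j
  fromℤ-injective fi≈fj =
    ℤ.≤-antisym (fromℤ-cancel-≤ (inj₂ fi≈fj)) (fromℤ-cancel-≤ (inj₂ (≈.sym fi≈fj)))

  sum-nonneg : ∀ {n} (t : Vector Carrier n) → (∀ i → 0# ≤ t i) → 0# ≤ sum t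
  sum-nonneg {zero}  t _   = ≤.refl
  sum-nonneg {suc n} t 0≤t = begin
    0#                       ≈⟨ +-identityˡ 0# ⟨
    0# + 0#                  ≤⟨ +-mono-≤ (0≤t zero) (sum-nonneg (t ∘ suc) (0≤t ∘ suc)) ⟩
    t zero + sum (t ∘ suc)   ∎
    where open ≤-Reasoning

  sum-nonpos : ∀ {n} (t : Vector Carrier n) → (∀ i → t i ≤ 0#) → sum t ≤ 0#
  sum-nonpos {zero}  t _   = ≤.refl
  sum-nonpos {suc n} t t≤0 = begin
    t zero + sum (t ∘ suc)   ≤⟨ +-mono-≤ (t≤0 zero) (sum-nonpos (t ∘ suc) (t≤0 ∘ suc)) ⟩
    0# + 0#                  ≈⟨ +-identityˡ 0# ⟩
    0#                       ∎
    where open ≤-Reasoning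

  sum-neg : ∀ {n} (t : Vector Carrier n) → (∀ i → t i ≤ 0#) → ∀ i → t i < 0# → sum t < 0#
  sum-neg t t≤0 zero t₀<0 = begin-strict
    t zero + sum (t ∘ suc)   <⟨ +-monoˡ-< _ t₀<0 ⟩
    0# + sum (t ∘ suc)       ≈⟨ +-identityˡ _ ⟩
    sum (t ∘ suc)            ≤⟨ sum-nonpos (t ∘ suc) (t≤0 ∘ suc) ⟩
    0#                       ∎
    where open ≤-Reasoning
  sum-neg t t≤0 (suc i) tᵢ<0 = begin-strict
    t zero + sum (t ∘ suc)   <⟨ +-monoʳ-< _ (sum-neg (t ∘ suc) (t≤0 ∘ suc) i tᵢ<0) ⟩
    t zero + 0#              ≈⟨ +-identityʳ _ ⟩
    t zero                   ≤⟨ t≤0 zero ⟩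
    0#                       ∎
    where open ≤-Reasoning

  sum-pos⁻ : ∀ {n} (t : Vector Carrier n) → 0# < sum t → ∃[ i ] 0# < t i
  sum-pos⁻ t 0<∑t with any? (λ i → 0# <.<? t i)
  ... | yes ∃i = ∃i
  ... | no ∄i  = contradiction (sum-nonpos t (λ i → ≮⇒≥ (λ 0<tᵢ → ∄i (i , 0<tᵢ)))) (<⇒≱ 0<∑t)

  sum-neg⁻ : ∀ {n} (t : Vector Carrier n) → sum t < 0# → ∃[ i ] t i < 0#
  sum-neg⁻ t ∑t<0 with any? (λ i → t i <.<? 0#)
  ... | yes ∃i = ∃i
  ... | no ∄i  = contradiction (sum-nonneg t (λ i → ≮⇒≥ (λ tᵢ<0 → ∄i (i , tᵢ<0)))) (<⇒≱ ∑t<0)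

module EuclideanProperties {c ℓ₁ ℓ₂ m ℓm} {K : OrderedField c ℓ₁ ℓ₂}
                           (E : EuclideanSpace K m ℓm) where
  open OrderedField K hiding (refl; sym; trans; zero)
  open OrderedFieldProperties K
  open EuclideanSpace E
  private
    module ≈ = OrderedField K using (refl; sym; trans)
    module ≈ᴹ = SetoidReasoning ≈ᴹ-setoid
    module ∑ᴹ = CommutativeMonoidSum +ᴹ-commutativeMonoid
  open GroupProperties +ᴹ-group using (inverseˡ-unique)
  open RingProperties ring using (+-inverseˡ-unique)

  -ᴹ-*ₗ : ∀ x u → -ᴹ (x *ₗ u) ≈ᴹ (- x) *ₗ u
  -ᴹ-*ₗ x u = ≈ᴹ-sym (inverseˡ-unique _ _ (begin
    (- x) *ₗ u +ᴹ x *ₗ u  ≈⟨ *ₗ-distribʳ u (- x) x ⟨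
    (- x + x) *ₗ u        ≈⟨ *ₗ-congʳ (-‿inverseˡ x) ⟩
    0# *ₗ u               ≈⟨ *ₗ-zeroˡ u ⟩
    0ᴹ                    ∎))
    where open ≈ᴹ

  *ₗ-sumᴹ : ∀ {n} x (v : Vector Carrierᴹ n) → x *ₗ ∑ᴹ.sum v ≈ᴹ ∑ᴹ.sum (λ i → x *ₗ v i)
  *ₗ-sumᴹ {zero}  x v = *ₗ-zeroʳ x
  *ₗ-sumᴹ {suc n} x v = ≈ᴹ-trans (*ₗ-distribˡ x _ _) (+ᴹ-congˡ (*ₗ-sumᴹ x (v ∘ suc)))

  sum-*ₗ : ∀ {n} (k : Vector Carrier n) u → sum k *ₗ u ≈ᴹ ∑ᴹ.sum (λ i → k i *ₗ u)
  sum-*ₗ {zero}  k u = *ₗ-zeroˡ u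
  sum-*ₗ {suc n} k u = ≈ᴹ-trans (*ₗ-distribʳ u _ _) (+ᴹ-congˡ (sum-*ₗ (k ∘ suc) u))

  combination-cong : ∀ {n} {k : Vector Carrier n} {u v : Vector Carrierᴹ n} →
    (∀ i → u i ≈ᴹ v i) → combination k u ≈ᴹ combination k v
  combination-cong u≈v = ∑ᴹ.sum-cong-≋ (λ i → *ₗ-congˡ (u≈v i))

  combination-linear : ∀ {n} (k l : Vector Carrier n) y (v : Vector Carrierᴹ n) →
    combination (λ i → k i + y * l i) v ≈ᴹ combination k v +ᴹ y *ₗ combination l v
  combination-linear k l y v = begin
    combination (λ i → k i + y * l i) v
      ≈⟨ ∑ᴹ.sum-cong-≋ (λ i → ≈ᴹ-trans (*ₗ-distribʳ (v i) _ _) (+ᴹ-congˡ (*ₗ-assoc y (l i) (v i)))) ⟩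
    ∑ᴹ.sum (λ i → k i *ₗ v i +ᴹ y *ₗ (l i *ₗ v i))
      ≈⟨ ∑ᴹ.∑-distrib-+ (λ i → k i *ₗ v i) (λ i → y *ₗ (l i *ₗ v i)) ⟩
    combination k v +ᴹ ∑ᴹ.sum (λ i → y *ₗ (l i *ₗ v i))
      ≈⟨ +ᴹ-congˡ (*ₗ-sumᴹ y (λ i → l i *ₗ v i)) ⟨
    combination k v +ᴹ y *ₗ combination l v ∎
    where open ≈ᴹ

  combination-combination : ∀ {n p} (k : Vector Carrier n) (l : Fin n → Vector Carrier p)
    (v : Vector Carrierᴹ p) →
    combination k (λ i → combination (l i) v) ≈ᴹ combination (λ a → sum (λ i → k i * l i a)) v
  combination-combination k l v = begin
    combination k (λ i → combination (l i) v)
      ≈⟨ ∑ᴹ.sum-cong-≋ (λ i → *ₗ-sumᴹ (k i) (λ a → l i a *ₗ v a)) ⟩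
    ∑ᴹ.sum (λ i → ∑ᴹ.sum (λ a → k i *ₗ (l i a *ₗ v a)))
      ≈⟨ ∑ᴹ.∑-comm (λ i a → k i *ₗ (l i a *ₗ v a)) ⟩
    ∑ᴹ.sum (λ a → ∑ᴹ.sum (λ i → k i *ₗ (l i a *ₗ v a)))
      ≈⟨ ∑ᴹ.sum-cong-≋ (λ a → ∑ᴹ.sum-cong-≋ (λ i → *ₗ-assoc (k i) (l i a) (v a))) ⟨
    ∑ᴹ.sum (λ a → ∑ᴹ.sum (λ i → (k i * l i a) *ₗ v a))
      ≈⟨ ∑ᴹ.sum-cong-≋ (λ a → sum-*ₗ (λ i → k i * l i a) (v a)) ⟨
    combination (λ a → sum (λ i → k i * l i a)) v ∎
    where open ≈ᴹ

  combination-single : ∀ {n} (k : Vector Carrier n) (v : Vector Carrierᴹ n) a →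
    (∀ b → b ≢ a → k b ≈ 0#) → combination k v ≈ᴹ k a *ₗ v a
  combination-single {suc n} k v zero k≈0 = begin
    k zero *ₗ v zero +ᴹ combination (k ∘ suc) (v ∘ suc)
      ≈⟨ +ᴹ-congˡ (∑ᴹ.sum-cong-≋ (λ b → ≈ᴹ-trans (*ₗ-congʳ (k≈0 (suc b) λ ())) (*ₗ-zeroˡ _))) ⟩
    k zero *ₗ v zero +ᴹ ∑ᴹ.sum {n} (λ _ → 0ᴹ)
      ≈⟨ +ᴹ-congˡ (∑ᴹ.sum-replicate-zero n) ⟩
    k zero *ₗ v zero +ᴹ 0ᴹ
      ≈⟨ +ᴹ-identityʳ _ ⟩
    k zero *ₗ v zero ∎
    where open ≈ᴹ
  combination-single k v (suc a) k≈0 = begin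
    k zero *ₗ v zero +ᴹ combination (k ∘ suc) (v ∘ suc)
      ≈⟨ +ᴹ-cong (≈ᴹ-trans (*ₗ-congʳ (k≈0 zero λ ())) (*ₗ-zeroˡ _))
                 (combination-single (k ∘ suc) (v ∘ suc) a
                   (λ b b≢a → k≈0 (suc b) (b≢a ∘ suc-injective))) ⟩
    0ᴹ +ᴹ k (suc a) *ₗ v (suc a)
      ≈⟨ +ᴹ-identityˡ _ ⟩
    k (suc a) *ₗ v (suc a) ∎
    where open ≈ᴹ

  ⟨⟩-zeroˡ : ∀ w → ⟨ 0ᴹ , w ⟩ ≈ 0#
  ⟨⟩-zeroˡ w = ≈.trans (⟨⟩-cong (≈ᴹ-sym (*ₗ-zeroˡ 0ᴹ)) ≈ᴹ-refl)
                (≈.trans (⟨⟩-homogenous 0# 0ᴹ w) (zeroˡ _))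

  ⟨⟩-negˡ : ∀ u w → ⟨ -ᴹ u , w ⟩ ≈ - ⟨ u , w ⟩
  ⟨⟩-negˡ u w = +-inverseˡ-unique _ _ (≈.trans (≈.sym (⟨⟩-additive (-ᴹ u) u w))
                  (≈.trans (⟨⟩-cong (-ᴹ‿inverseˡ u) ≈ᴹ-refl) (⟨⟩-zeroˡ w)))

  ⟨⟩-sub : ∀ u k v w → ⟨ u +ᴹ -ᴹ (k *ₗ v) , w ⟩ ≈ ⟨ u , w ⟩ - k * ⟨ v , w ⟩
  ⟨⟩-sub u k v w = ≈.trans (⟨⟩-additive u _ w)
    (+-congˡ (≈.trans (⟨⟩-negˡ _ w) (-‿cong (⟨⟩-homogenous k v w))))

  normSq-sub : ∀ u k v → let x = u +ᴹ -ᴹ (k *ₗ v) in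
    ⟨ x , x ⟩ ≈ ⟨ u , u ⟩ - k * ⟨ u , v ⟩ - k * (⟨ u , v ⟩ - k * ⟨ v , v ⟩)
  normSq-sub u k v = begin
    ⟨ x , x ⟩                         ≈⟨ ⟨⟩-sub u k v x ⟩
    ⟨ u , x ⟩ - k * ⟨ v , x ⟩         ≈⟨ +-cong ux (-‿cong (*-congˡ vx)) ⟩
    ⟨ u , u ⟩ - k * ⟨ u , v ⟩ - k * (⟨ u , v ⟩ - k * ⟨ v , v ⟩) ∎
    where
    open SetoidReasoning setoid
    x = u +ᴹ -ᴹ (k *ₗ v)
    ux : ⟨ u , x ⟩ ≈ ⟨ u , u ⟩ - k * ⟨ u , v ⟩
    ux = ≈.trans (⟨⟩-sym u x) (≈.trans (⟨⟩-sub u k v u) (+-congˡ (-‿cong (*-congˡ (⟨⟩-sym v u)))))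
    vx : ⟨ v , x ⟩ ≈ ⟨ u , v ⟩ - k * ⟨ v , v ⟩
    vx = ≈.trans (⟨⟩-sym v x) (⟨⟩-sub u k v v)

  ⟨⟩-combination : ∀ {n} (k : Vector Carrier n) (v : Vector Carrierᴹ n) w →
    ⟨ combination k v , w ⟩ ≈ sum (λ i → k i * ⟨ v i , w ⟩)
  ⟨⟩-combination {zero}  k v w = ⟨⟩-zeroˡ w
  ⟨⟩-combination {suc n} k v w = ≈.trans (⟨⟩-additive _ _ w)
    (+-cong (⟨⟩-homogenous (k zero) (v zero) w) (⟨⟩-combination (k ∘ suc) (v ∘ suc) w))

module RootSystemProperties {c ℓ₁ ℓ₂ m ℓm} {K : OrderedField c ℓ₁ ℓ₂}
                            {E : EuclideanSpace K m ℓm} (Φ : RootSystem E) where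
  open OrderedField K hiding (refl; sym; trans; zero)
  open OrderedFieldProperties K
  open EuclideanSpace E
  open EuclideanProperties E
  open RootSystem Φ
  private module ≈ = OrderedField K using (refl; sym; trans)
  open Solver using (solve; _:=_; _:+_; _:*_; :-_; _:-_; con)

  Long⊎Short : ∀ i → Long i ⊎ Short i
  Long⊎Short i with any? (λ j → normSq i <.<? normSq j)
  ... | yes short = inj₂ short
  ... | no ¬short = inj₁ (λ j → ≮⇒≥ (λ i<j → ¬short (j , i<j)))

  Short⇒¬Long : ∀ {i} → Short i → ¬ Long i
  Short⇒¬Long (j , i<j) long = <⇒≱ i<j (long j)

  Short∧Long⇒< : ∀ {i j} → Short i → Long j → normSq i < normSq j
  Short∧Long⇒< (k , i<k) long = ≰⇒> (λ j≤i → <⇒≱ i<k (≤.trans (long k) j≤i))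

  Long-resp-≤ : ∀ {i j} → normSq i ≤ normSq j → Long i → Long j
  Long-resp-≤ i≤j long k = ≤.trans (long k) i≤j

  Short-resp-≤ : ∀ {i j} → normSq j ≤ normSq i → Short i → Short j
  Short-resp-≤ j≤i (k , i<k) = k , ≰⇒> (λ k≤j → <⇒≱ i<k (≤.trans k≤j j≤i))

  normSq-pos : ∀ i → 0# < normSq i
  normSq-pos i = nonneg∧≢0⇒pos (⟨⟩-nonneg (root i)) (nonzero i ∘ ⟨⟩-definite (root i))

  integral′ : ∀ i j → ⟨ root i , root j ⟩ + ⟨ root i , root j ⟩ ≈ fromℤ (cartan i j) * normSq j
  integral′ i j = ≈.trans
    (≈.sym (≈.trans (distribʳ _ 1# 1#) (+-cong (*-identityˡ _) (*-identityˡ _)))) (integral i j)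

  cartan-pos : ∀ i j → 0# < ⟨ root i , root j ⟩ → 0ℤ ℤ.< cartan i j
  cartan-pos i j 0<ij = ℤ.≰⇒> λ c≤0 → <⇒≱ (double-pos 0<ij) (begin
    ⟨ root i , root j ⟩ + ⟨ root i , root j ⟩  ≈⟨ integral′ i j ⟩
    fromℤ (cartan i j) * normSq j              ≈⟨ *-comm _ _ ⟩
    normSq j * fromℤ (cartan i j)
      ≤⟨ *-nonneg-nonpos (⟨⟩-nonneg (root j)) (fromℤ-mono-≤ c≤0) ⟩
    0#                                         ∎)
    where open ≤-Reasoning

  cartan-neg : ∀ i j → ⟨ root i , root j ⟩ < 0# → cartan i j ℤ.< 0ℤ
  cartan-neg i j ij<0 = ℤ.≰⇒> λ 0≤c → <⇒≱ (double-neg ij<0) (begin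
    0#                                         ≤⟨ *-nonneg (fromℤ-mono-≤ 0≤c) (⟨⟩-nonneg (root j)) ⟩
    fromℤ (cartan i j) * normSq j              ≈⟨ integral′ i j ⟨
    ⟨ root i , root j ⟩ + ⟨ root i , root j ⟩  ∎)
    where open ≤-Reasoning

  cartan≢0 : ∀ i j → ⟨ root i , root j ⟩ < 0# → cartan i j ≢ 0ℤ
  cartan≢0 i j ij<0 = ℤ.<⇒≢ (cartan-neg i j ij<0)

  cartan≡0 : ∀ i j → ⟨ root i , root j ⟩ ≈ 0# → cartan i j ≡ 0ℤ
  cartan≡0 i j ij≈0 with ℤ.<-cmp (cartan i j) 0ℤ
  ... | tri≈ _ c≡0 _ = c≡0
  ... | tri< c<0 _ _ = contradiction
    (≤.trans (inj₂ (≈.sym ij+ij≈0)) (inj₂ (≈.trans (integral′ i j) (*-comm _ _))))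
    (<⇒≱ (*-pos-neg (normSq-pos j) (fromℤ-mono-< c<0)))
    where
    ij+ij≈0 : ⟨ root i , root j ⟩ + ⟨ root i , root j ⟩ ≈ 0#
    ij+ij≈0 = ≈.trans (+-cong ij≈0 ij≈0) (+-identityˡ 0#)
  ... | tri> _ _ 0<c = contradiction
    (inj₂ (≈.trans (≈.sym (integral′ i j)) (≈.trans (+-cong ij≈0 ij≈0) (+-identityˡ 0#))))
    (<⇒≱ (*-pos (fromℤ-mono-< 0<c) (normSq-pos j)))

  ⟨⟩<0⇒Adjacent : ∀ {D i j} → D i → D j → ⟨ root i , root j ⟩ < 0# → Adjacent D i j
  ⟨⟩<0⇒Adjacent {i = i} {j} Di Dj ij<0 =
    Di , Dj ,
    (λ i≡j → <.asym ij<0 (subst (λ k → 0# < ⟨ root i , root k ⟩) i≡j (normSq-pos i))) ,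
    λ bonds≡0 → [ cartan≢0 i j ij<0 , cartan≢0 j i (<.<-respˡ-≈ (⟨⟩-sym _ _) ij<0) ]′
      (ℤ.i*j≡0⇒i≡0∨j≡0 (cartan i j) bonds≡0)

  Adjacent⇒⟨⟩<0 : ∀ {D i j} → ⟨ root i , root j ⟩ ≤ 0# → Adjacent D i j → ⟨ root i , root j ⟩ < 0#
  Adjacent⇒⟨⟩<0 (inj₁ ij<0) _ = ij<0
  Adjacent⇒⟨⟩<0 {i = i} {j} (inj₂ ij≈0) (_ , _ , _ , bonds≢0) =
    contradiction (cong (ℤ._* cartan j i) (cartan≡0 i j ij≈0)) bonds≢0

  reflect : Root → Root → Root
  reflect i j = proj₁ (reflection i j)

  ⟨reflect⟩ : ∀ i j w →
    ⟨ root (reflect i j) , w ⟩ ≈ ⟨ root i , w ⟩ - fromℤ (cartan i j) * ⟨ root j , w ⟩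
  ⟨reflect⟩ i j w = ≈.trans (⟨⟩-cong (proj₂ (reflection i j)) ≈ᴹ-refl)
    (⟨⟩-sub (root i) (fromℤ (cartan i j)) (root j) w)

  ⟨reflect⟩-self : ∀ i j → ⟨ root (reflect i j) , root j ⟩ ≈ - ⟨ root i , root j ⟩
  ⟨reflect⟩-self i j = begin
    ⟨ root (reflect i j) , root j ⟩                        ≈⟨ ⟨reflect⟩ i j (root j) ⟩
    ⟨ root i , root j ⟩ - fromℤ (cartan i j) * normSq j    ≈⟨ +-congˡ (-‿cong (integral′ i j)) ⟨
    ⟨ root i , root j ⟩ - (⟨ root i , root j ⟩ + ⟨ root i , root j ⟩)
      ≈⟨ solve 1 (λ x → x :- (x :+ x) := :- x) ≈.refl _ ⟩
    - ⟨ root i , root j ⟩                                  ∎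
    where open SetoidReasoning setoid

  normSq-reflect : ∀ i j → normSq (reflect i j) ≈ normSq i
  normSq-reflect i j = begin
    normSq (reflect i j)             ≈⟨ ⟨⟩-cong (proj₂ (reflection i j)) (proj₂ (reflection i j)) ⟩
    ⟨ x , x ⟩                        ≈⟨ normSq-sub (root i) k (root j) ⟩
    normSq i - k * b - k * (b - k * normSq j)
      ≈⟨ +-congˡ (-‿cong (*-congˡ (+-congˡ (-‿cong (integral′ i j))))) ⟨
    normSq i - k * b - k * (b - (b + b))
      ≈⟨ solve 3 (λ n k b → n :- k :* b :- k :* (b :- (b :+ b)) := n) ≈.refl _ k b ⟩
    normSq i                         ∎
    where
    open SetoidReasoning setoid
    k = fromℤ (cartan i j)
    b = ⟨ root i , root j ⟩
    x = root i +ᴹ -ᴹ (k *ₗ root j)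

  Long-reflect : ∀ i j → Long i → Long (reflect i j)
  Long-reflect i j = Long-resp-≤ (inj₂ (≈.sym (normSq-reflect i j)))

  Short-reflect : ∀ i j → Short i → Short (reflect i j)
  Short-reflect i j = Short-resp-≤ (inj₂ (normSq-reflect i j))

  -- If z ⟨i,j^∨⟩ were at least 2, then i − z j would have negative squared length.
  cartan≡unit : ∀ i j z → z ℤ.* z ≡ 1ℤ → normSq i < normSq j →
                0# < fromℤ z * ⟨ root i , root j ⟩ → cartan i j ≡ z
  cartan≡unit i j z z²≡1 i<j 0<zb = cartan≡z
    where
    b = ⟨ root i , root j ⟩
    J = normSq j
    k = fromℤ z
    n = z ℤ.* cartan i j
    x = root i +ᴹ -ᴹ (k *ₗ root j)

    nJ≈2zb : fromℤ n * J ≈ k * b + k * b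
    nJ≈2zb = begin
      fromℤ n * J                     ≈⟨ *-congʳ (fromℤ-* z (cartan i j)) ⟩
      k * fromℤ (cartan i j) * J      ≈⟨ *-assoc _ _ _ ⟩
      k * (fromℤ (cartan i j) * J)    ≈⟨ *-congˡ (integral′ i j) ⟨
      k * (b + b)                     ≈⟨ distribˡ k b b ⟩
      k * b + k * b                   ∎
      where open SetoidReasoning setoid

    0<n : 0ℤ ℤ.< n
    0<n = ℤ.≰⇒> λ n≤0 → <⇒≱ (double-pos 0<zb) (begin
      k * b + k * b   ≈⟨ nJ≈2zb ⟨
      fromℤ n * J     ≈⟨ *-comm _ _ ⟩
      J * fromℤ n     ≤⟨ *-nonneg-nonpos (⟨⟩-nonneg (root j)) (fromℤ-mono-≤ n≤0) ⟩
      0#              ∎)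
      where open ≤-Reasoning

    k²≈1 : k * k ≈ fromℤ 1ℤ
    k²≈1 = ≈.trans (≈.sym (fromℤ-* z z)) (reflexive (cong fromℤ z²≡1))

    n≤1 : n ℤ.≤ 1ℤ
    n≤1 = ℤ.≮⇒≥ λ 1<n → <⇒≱ (begin-strict
      ⟨ x , x ⟩
        ≈⟨ normSq-sub (root i) k (root j) ⟩
      normSq i - k * b - k * (b - k * J)
        ≈⟨ solve 4 (λ I k b J → I :- k :* b :- k :* (b :- k :* J)
                             := I :+ (k :* k :* J :- (k :* b :+ k :* b))) ≈.refl _ k b J ⟩
      normSq i + (k * k * J - (k * b + k * b))
        ≈⟨ +-congˡ (+-cong (*-congʳ k²≈1) (-‿cong (≈.sym (≈.trans (*-comm _ _) nJ≈2zb)))) ⟩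
      normSq i + (fromℤ 1ℤ * J - J * fromℤ n)
        <⟨ +-monoˡ-< _ i<j ⟩
      J + (fromℤ 1ℤ * J - J * fromℤ n)
        ≈⟨ +-comm _ _ ⟩
      fromℤ 1ℤ * J - J * fromℤ n + J
        ≤⟨ +-monoˡ-≤ J (+-mono-≤ ≤.refl (neg-mono-≤
             (*-monoˡ-≤ (⟨⟩-nonneg (root j)) (fromℤ-mono-≤ (ℤ.i<j⇒suc[i]≤j 1<n))))) ⟩
      fromℤ 1ℤ * J - J * fromℤ (+ 2) + J
        ≈⟨ solve 1 (λ J → con 1ℤ :* J :- J :* con (+ 2) :+ J := con 0ℤ) ≈.refl J ⟩
      0# ∎) (⟨⟩-nonneg x)
      where open ≤-Reasoning

    cartan≡z : cartan i j ≡ z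
    cartan≡z = begin
      cartan i j                    ≡⟨ ℤ.*-identityˡ _ ⟨
      1ℤ ℤ.* cartan i j             ≡⟨ cong (ℤ._* cartan i j) z²≡1 ⟨
      z ℤ.* z ℤ.* cartan i j        ≡⟨ ℤ.*-assoc z z _ ⟩
      z ℤ.* n                       ≡⟨ cong (z ℤ.*_) (ℤ.≤-antisym n≤1 (ℤ.i<j⇒suc[i]≤j 0<n)) ⟩
      z ℤ.* 1ℤ                      ≡⟨ ℤ.*-identityʳ z ⟩
      z                             ∎
      where open ≡.≡-Reasoning

open CommutativeMonoidSum ℕ.+-0-commutativeMonoid using () renaming (sum to sumℕ)

sumℕ-≤ : ∀ {n} (f g : Vector ℕ n) → (∀ b → f b ℕ.≤ g b) → sumℕ f ℕ.≤ sumℕ g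
sumℕ-≤ {zero}  f g f≤g = ℕ.z≤n
sumℕ-≤ {suc n} f g f≤g = ℕ.+-mono-≤ (f≤g zero) (sumℕ-≤ _ _ (f≤g ∘ suc))

sumℕ-< : ∀ {n} (f g : Vector ℕ n) a → (∀ b → b ≢ a → f b ℕ.≤ g b) → f a ℕ.< g a →
         sumℕ f ℕ.< sumℕ g
sumℕ-< f g zero f≤g fa<ga =
  ℕ.+-mono-<-≤ fa<ga (sumℕ-≤ _ _ (λ b → f≤g (suc b) λ ()))
sumℕ-< f g (suc a) f≤g fa<ga =
  ℕ.+-mono-≤-< (f≤g zero λ ()) (sumℕ-< _ _ a (λ b b≢a → f≤g (suc b) (b≢a ∘ suc-injective)) fa<ga)

i<j⇒0<j-i : ∀ {i j} → i ℤ.< j → 0ℤ ℤ.< j ℤ.- i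
i<j⇒0<j-i {i} {j} i<j = subst (ℤ._< j ℤ.- i) (ℤ.+-inverseʳ i) (ℤ.+-monoˡ-< (ℤ.- i) i<j)

∣x-o∣<∣y-o∣ : ∀ {o x y} → o ℤ.≤ x → x ℤ.< y → ℤ.∣ x ℤ.- o ∣ ℕ.< ℤ.∣ y ℤ.- o ∣
∣x-o∣<∣y-o∣ {o} {x} {y} o≤x x<y = ℤ.drop‿+<+ (begin-strict
  + ℤ.∣ x ℤ.- o ∣  ≡⟨ ℤ.0≤i⇒+∣i∣≡i (ℤ.i≤j⇒0≤j-i o≤x) ⟩
  x ℤ.- o          <⟨ ℤ.+-monoˡ-< (ℤ.- o) x<y ⟩
  y ℤ.- o          ≡⟨ ℤ.0≤i⇒+∣i∣≡i (ℤ.i≤j⇒0≤j-i (ℤ.≤-trans o≤x (ℤ.<⇒≤ x<y))) ⟨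
  + ℤ.∣ y ℤ.- o ∣  ∎)
  where open ℤ.≤-Reasoning

module SimpleSystemProperties {c ℓ₁ ℓ₂ m ℓm} {K : OrderedField c ℓ₁ ℓ₂}
                              {E : EuclideanSpace K m ℓm} {Φ : RootSystem E}
                              (Π : SimpleSystem Φ) where
  open OrderedField K hiding (refl; sym; trans; zero)
  open OrderedFieldProperties K
  open EuclideanSpace E
  open EuclideanProperties E
  open RootSystem Φ
  open RootSystemProperties Φ
  open SimpleSystem Π
  private
    module ≈ = OrderedField K using (refl; sym; trans)
    module ≈ᴹ = SetoidReasoning ≈ᴹ-setoid
  open GroupProperties +ᴹ-group using (//-rightDividesˡ)
  open Solver using (solve; _:=_; _:+_; _:*_; :-_; _:-_; con)

  α : Fin rank → Carrierᴹ
  α a = root (simple a)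

  coeff-unique : ∀ γ k → root γ ≈ᴹ combination k α → ∀ a → fromℤ (coeff γ a) ≈ k a
  coeff-unique γ k γ≈k a = begin
    x                          ≈⟨ solve 2 (λ x y → x := x :+ con -1ℤ :* y :+ y) ≈.refl x (k a) ⟩
    x + fromℤ -1ℤ * k a + k a  ≈⟨ +-congʳ (independent _ combination≈0 a) ⟩
    0# + k a                   ≈⟨ +-identityˡ _ ⟩
    k a                        ∎
    where
    open SetoidReasoning setoid
    x = fromℤ (coeff γ a)
    combination≈0 : combination (λ b → fromℤ (coeff γ b) + fromℤ -1ℤ * k b) α ≈ᴹ 0ᴹ
    combination≈0 = ≈ᴹ.begin
      combination (λ b → fromℤ (coeff γ b) + fromℤ -1ℤ * k b) α
        ≈ᴹ.≈⟨ combination-linear _ k _ α ⟩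
      combination (fromℤ ∘ coeff γ) α +ᴹ fromℤ -1ℤ *ₗ combination k α
        ≈ᴹ.≈⟨ +ᴹ-cong (expansion γ) (*ₗ-congˡ γ≈k) ⟨
      root γ +ᴹ fromℤ -1ℤ *ₗ root γ
        ≈ᴹ.≈⟨ +ᴹ-congˡ (-ᴹ-*ₗ (fromℤ 1ℤ) (root γ)) ⟨
      root γ +ᴹ -ᴹ (fromℤ 1ℤ *ₗ root γ)
        ≈ᴹ.≈⟨ +ᴹ-congˡ (-ᴹ‿cong (≈ᴹ-trans (*ₗ-congʳ fromℤ-1) (*ₗ-identityˡ _))) ⟩
      root γ +ᴹ -ᴹ root γ
        ≈ᴹ.≈⟨ -ᴹ‿inverseʳ _ ⟩
      0ᴹ ≈ᴹ.∎

  coeff-reflect : ∀ i j a → coeff (reflect i j) a ≡ coeff i a ℤ.- cartan i j ℤ.* coeff j a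
  coeff-reflect i j a = fromℤ-injective (begin
    fromℤ (coeff (reflect i j) a)
      ≈⟨ coeff-unique _ _ expansion′ a ⟩
    fromℤ (coeff i a) + - z * fromℤ (coeff j a)
      ≈⟨ solve 3 (λ x z y → x :+ :- z :* y := x :- z :* y) ≈.refl _ z _ ⟩
    fromℤ (coeff i a) - z * fromℤ (coeff j a)
      ≈⟨ +-congˡ (-‿cong (fromℤ-* (cartan i j) (coeff j a))) ⟨
    fromℤ (coeff i a) - fromℤ (cartan i j ℤ.* coeff j a)
      ≈⟨ +-congˡ (fromℤ-neg (cartan i j ℤ.* coeff j a)) ⟨
    fromℤ (coeff i a) + fromℤ (ℤ.- (cartan i j ℤ.* coeff j a))
      ≈⟨ fromℤ-+ (coeff i a) (ℤ.- (cartan i j ℤ.* coeff j a)) ⟨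
    fromℤ (coeff i a ℤ.- cartan i j ℤ.* coeff j a) ∎)
    where
    open SetoidReasoning setoid
    z = fromℤ (cartan i j)
    expansion′ : root (reflect i j) ≈ᴹ
      combination (λ b → fromℤ (coeff i b) + - z * fromℤ (coeff j b)) α
    expansion′ = ≈ᴹ-trans (proj₂ (reflection i j))
      (≈ᴹ-trans (+ᴹ-cong (expansion i) (≈ᴹ-trans (-ᴹ-*ₗ z _) (*ₗ-congˡ (expansion j))))
        (≈ᴹ-sym (combination-linear _ _ _ α)))

  indicator : Fin rank → Fin rank → ℤ
  indicator a b with b ≟ a
  ... | yes _ = 1ℤ
  ... | no _  = 0ℤ

  indicator-≡ : ∀ a → indicator a a ≡ 1ℤ
  indicator-≡ a with a ≟ a
  ... | yes _  = refl
  ... | no a≢a = contradiction refl a≢a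

  indicator-≢ : ∀ a b → b ≢ a → indicator a b ≡ 0ℤ
  indicator-≢ a b b≢a with b ≟ a
  ... | yes b≡a = contradiction b≡a b≢a
  ... | no _    = refl

  coeff-simple : ∀ a b → coeff (simple a) b ≡ indicator a b
  coeff-simple a b = fromℤ-injective (coeff-unique (simple a) (fromℤ ∘ indicator a) (≈ᴹ-sym (begin
    combination (fromℤ ∘ indicator a) α
      ≈⟨ combination-single _ α a (λ b b≢a → reflexive (cong fromℤ (indicator-≢ a b b≢a))) ⟩
    fromℤ (indicator a a) *ₗ α a  ≈⟨ *ₗ-congʳ (reflexive (cong fromℤ (indicator-≡ a))) ⟩
    fromℤ 1ℤ *ₗ α a               ≈⟨ *ₗ-congʳ fromℤ-1 ⟩
    1# *ₗ α a                     ≈⟨ *ₗ-identityˡ _ ⟩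
    α a                           ∎)) b)
    where open SetoidReasoning ≈ᴹ-setoid

  coeff-simple-≡ : ∀ a → coeff (simple a) a ≡ 1ℤ
  coeff-simple-≡ a = ≡.trans (coeff-simple a a) (indicator-≡ a)

  coeff-simple-≢ : ∀ {a b} → b ≢ a → coeff (simple a) b ≡ 0ℤ
  coeff-simple-≢ {a} {b} b≢a = ≡.trans (coeff-simple a b) (indicator-≢ a b b≢a)

  coeff-reflect-≢ : ∀ γ {a b} → b ≢ a → coeff (reflect γ (simple a)) b ≡ coeff γ b
  coeff-reflect-≢ γ {a} {b} b≢a = begin
    coeff (reflect γ (simple a)) b     ≡⟨ coeff-reflect γ (simple a) b ⟩
    coeff γ b ℤ.- z ℤ.* coeff (simple a) b
      ≡⟨ cong (λ x → coeff γ b ℤ.- z ℤ.* x) (coeff-simple-≢ b≢a) ⟩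
    coeff γ b ℤ.- z ℤ.* 0ℤ             ≡⟨ cong (λ x → coeff γ b ℤ.- x) (ℤ.*-zeroʳ z) ⟩
    coeff γ b ℤ.+ 0ℤ                   ≡⟨ ℤ.+-identityʳ _ ⟩
    coeff γ b                          ∎
    where
    open ≡.≡-Reasoning
    z = cartan γ (simple a)

  coeff-reflect-≡ : ∀ γ a → coeff (reflect γ (simple a)) a ≡ coeff γ a ℤ.- cartan γ (simple a)
  coeff-reflect-≡ γ a = begin
    coeff (reflect γ (simple a)) a     ≡⟨ coeff-reflect γ (simple a) a ⟩
    coeff γ a ℤ.- z ℤ.* coeff (simple a) a
      ≡⟨ cong (λ x → coeff γ a ℤ.- z ℤ.* x) (coeff-simple-≡ a) ⟩
    coeff γ a ℤ.- z ℤ.* 1ℤ             ≡⟨ cong (λ x → coeff γ a ℤ.- x) (ℤ.*-identityʳ z) ⟩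
    coeff γ a ℤ.- z                    ∎
    where
    open ≡.≡-Reasoning
    z = cartan γ (simple a)

  coeff-reflect-< : ∀ γ a → 0# < ⟨ root γ , α a ⟩ → coeff (reflect γ (simple a)) a ℤ.< coeff γ a
  coeff-reflect-< γ a 0<γa = begin-strict
    coeff (reflect γ (simple a)) a      ≡⟨ coeff-reflect-≡ γ a ⟩
    coeff γ a ℤ.- cartan γ (simple a)
      <⟨ ℤ.+-monoʳ-< (coeff γ a) (ℤ.neg-mono-< (cartan-pos γ (simple a) 0<γa)) ⟩
    coeff γ a ℤ.+ 0ℤ                    ≡⟨ ℤ.+-identityʳ _ ⟩
    coeff γ a                           ∎
    where open ℤ.≤-Reasoning

  coeff-reflect-> : ∀ γ a → ⟨ root γ , α a ⟩ < 0# → coeff γ a ℤ.< coeff (reflect γ (simple a)) a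
  coeff-reflect-> γ a γa<0 = begin-strict
    coeff γ a                           ≡⟨ ℤ.+-identityʳ _ ⟨
    coeff γ a ℤ.+ 0ℤ
      <⟨ ℤ.+-monoʳ-< (coeff γ a) (ℤ.neg-mono-< (cartan-neg γ (simple a) γa<0)) ⟩
    coeff γ a ℤ.- cartan γ (simple a)   ≡⟨ coeff-reflect-≡ γ a ⟨
    coeff (reflect γ (simple a)) a      ∎
    where open ℤ.≤-Reasoning

  simple-obtuse : ∀ {a b} → b ≢ a → ⟨ α b , α a ⟩ ≤ 0#
  simple-obtuse {a} {b} b≢a = ≮⇒≥ λ 0<ba →
    [ (λ 0≤γ → ℤ.<⇒≱
        (subst (coeff γ a ℤ.<_) (coeff-simple-≢ (b≢a ∘ ≡.sym)) (coeff-reflect-< (simple b) a 0<ba))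
        (0≤γ a))
    , (λ γ≤0 → ℤ.<⇒≱ (ℤ.+<+ (ℕ.s≤s ℕ.z≤n))
        (subst (ℤ._≤ 0ℤ) (≡.trans (coeff-reflect-≢ (simple b) b≢a) (coeff-simple-≡ b)) (γ≤0 b))) ]′
    (oneSigned γ)
    where γ = reflect (simple b) (simple a)

  ≼⇒coeff-≤ : ∀ {γ δ} → γ ≼ δ → ∀ a → coeff γ a ℤ.≤ coeff δ a
  ≼⇒coeff-≤ {γ} {δ} (k , 0≤k , k≈0 , δ-γ≈k) a = fromℤ-cancel-≤ (begin
    fromℤ (coeff γ a)               ≈⟨ +-identityʳ _ ⟨
    fromℤ (coeff γ a) + 0#          ≤⟨ +-mono-≤ ≤.refl (sum-nonneg _ term-nonneg) ⟩
    fromℤ (coeff γ a) + l a         ≈⟨ +-congˡ (*-identityˡ _) ⟨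
    fromℤ (coeff γ a) + 1# * l a    ≈⟨ coeff-unique δ _ expansion′ a ⟨
    fromℤ (coeff δ a)               ∎)
    where
    open ≤-Reasoning
    l : Fin rank → Carrier
    l b = sum (λ i → k i * fromℤ (coeff i b))
    term-nonneg : ∀ i → 0# ≤ k i * fromℤ (coeff i a)
    term-nonneg i with all? (λ b → 0ℤ ℤ.≤? coeff i b)
    ... | yes 0≤i = *-nonneg (0≤k i) (fromℤ-mono-≤ (0≤i a))
    ... | no ¬0≤i = inj₂ (≈.sym (≈.trans (*-congʳ (k≈0 i ¬0≤i)) (zeroˡ _)))
    expansion′ : root δ ≈ᴹ combination (λ b → fromℤ (coeff γ b) + 1# * l b) α
    expansion′ = ≈ᴹ.begin
      root δ                               ≈ᴹ.≈⟨ //-rightDividesˡ (root γ) (root δ) ⟨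
      root δ +ᴹ -ᴹ root γ +ᴹ root γ        ≈ᴹ.≈⟨ +ᴹ-comm _ _ ⟩
      root γ +ᴹ (root δ +ᴹ -ᴹ root γ)      ≈ᴹ.≈⟨ +ᴹ-cong (expansion γ) (≈ᴹ-trans δ-γ≈k k≈l) ⟩
      combination (fromℤ ∘ coeff γ) α +ᴹ combination l α ≈ᴹ.≈⟨ +ᴹ-congˡ (*ₗ-identityˡ _) ⟨
      combination (fromℤ ∘ coeff γ) α +ᴹ 1# *ₗ combination l α ≈ᴹ.≈⟨ combination-linear _ l 1# α ⟨
      combination (λ b → fromℤ (coeff γ b) + 1# * l b) α ≈ᴹ.∎
      where
      k≈l : combination k root ≈ᴹ combination l α
      k≈l = ≈ᴹ-trans (combination-cong expansion) (combination-combination k _ α)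

  ⟨⟩-expansion : ∀ γ w → ⟨ root γ , w ⟩ ≈ sum (λ a → fromℤ (coeff γ a) * ⟨ α a , w ⟩)
  ⟨⟩-expansion γ w = ≈.trans (⟨⟩-cong (expansion γ) ≈ᴹ-refl) (⟨⟩-combination _ α w)

  ⟨⟩-expansion-from : ∀ μ γ w → ⟨ root γ , w ⟩ ≈
    ⟨ root μ , w ⟩ + sum (λ a → fromℤ (coeff γ a ℤ.- coeff μ a) * ⟨ α a , w ⟩)
  ⟨⟩-expansion-from μ γ w = begin
    ⟨ root γ , w ⟩
      ≈⟨ ⟨⟩-expansion γ w ⟩
    sum (λ a → fromℤ (coeff γ a) * ⟨ α a , w ⟩)
      ≈⟨ sum-cong-≋ term ⟩
    sum (λ a → fromℤ (coeff μ a) * ⟨ α a , w ⟩ + fromℤ (coeff γ a ℤ.- coeff μ a) * ⟨ α a , w ⟩)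
      ≈⟨ ∑-distrib-+ (λ a → fromℤ (coeff μ a) * ⟨ α a , w ⟩) _ ⟩
    sum (λ a → fromℤ (coeff μ a) * ⟨ α a , w ⟩)
      + sum (λ a → fromℤ (coeff γ a ℤ.- coeff μ a) * ⟨ α a , w ⟩)
      ≈⟨ +-congʳ (⟨⟩-expansion μ w) ⟨
    ⟨ root μ , w ⟩ + sum (λ a → fromℤ (coeff γ a ℤ.- coeff μ a) * ⟨ α a , w ⟩) ∎
    where
    open SetoidReasoning setoid
    term : ∀ a → fromℤ (coeff γ a) * ⟨ α a , w ⟩ ≈
      fromℤ (coeff μ a) * ⟨ α a , w ⟩ + fromℤ (coeff γ a ℤ.- coeff μ a) * ⟨ α a , w ⟩
    term a = begin
      fromℤ (coeff γ a) * ⟨ α a , w ⟩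
        ≡⟨ cong (λ z → fromℤ z * ⟨ α a , w ⟩) (x≡y+[x-y] (coeff γ a) (coeff μ a)) ⟩
      fromℤ (coeff μ a ℤ.+ (coeff γ a ℤ.- coeff μ a)) * ⟨ α a , w ⟩
        ≈⟨ *-congʳ (fromℤ-+ (coeff μ a) (coeff γ a ℤ.- coeff μ a)) ⟩
      (fromℤ (coeff μ a) + fromℤ (coeff γ a ℤ.- coeff μ a)) * ⟨ α a , w ⟩
        ≈⟨ distribʳ _ _ _ ⟩
      fromℤ (coeff μ a) * ⟨ α a , w ⟩ + fromℤ (coeff γ a ℤ.- coeff μ a) * ⟨ α a , w ⟩ ∎
      where
      x≡y+[x-y] : ∀ x y → x ≡ y ℤ.+ (x ℤ.- y)
      x≡y+[x-y] = ℤ-RingSolver.solve-∀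

  height : (Fin rank → ℤ) → Root → ℕ
  height o γ = sumℕ (λ a → ℤ.∣ coeff γ a ℤ.- o a ∣)

  height-reflect : ∀ o γ a → 0# < ⟨ root γ , α a ⟩ → o a ℤ.≤ coeff (reflect γ (simple a)) a →
                   height o (reflect γ (simple a)) ℕ.< height o γ
  height-reflect o γ a 0<γa o≤γ′ = sumℕ-< _ _ a
    (λ b b≢a → ℕ.≤-reflexive (cong (λ z → ℤ.∣ z ℤ.- o b ∣) (coeff-reflect-≢ γ b≢a)))
    (∣x-o∣<∣y-o∣ o≤γ′ (coeff-reflect-< γ a 0<γa))

  ⟨⟩-neg⇒Supp : ∀ ν w → Positive ν → ⟨ root ν , w ⟩ < 0# → ∃[ a ] Supp ν a × ⟨ α a , w ⟩ < 0#
  ⟨⟩-neg⇒Supp ν w 0≤ν νw<0 with sum-neg⁻ _ (<.<-respˡ-≈ (⟨⟩-expansion ν w) νw<0)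
  ... | a , term<0 with *-neg⁻ (fromℤ-mono-≤ (0≤ν a)) term<0
  ... | 0<νa , aw<0 = a , ℤ.<⇒≢ (fromℤ-cancel-< 0<νa) ∘ ≡.sym , aw<0

  ⟨⟩-pos⇒Supp : ∀ ν w → Positive ν → 0# < ⟨ root ν , w ⟩ → ∃[ a ] Supp ν a × 0# < ⟨ α a , w ⟩
  ⟨⟩-pos⇒Supp ν w 0≤ν 0<νw with sum-pos⁻ _ (<.<-respʳ-≈ (⟨⟩-expansion ν w) 0<νw)
  ... | a , 0<term with *-pos⁻ (fromℤ-mono-≤ (0≤ν a)) 0<term
  ... | 0<νa , 0<aw = a , ℤ.<⇒≢ (fromℤ-cancel-< 0<νa) ∘ ≡.sym , 0<aw

  component-short : ∀ {D : Pred Root 0ℓ} ν → Acc ℕ._<_ (height (λ _ → 0ℤ) ν) →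
    Positive ν → Short ν → (∀ a → Supp ν a → D (simple a)) →
    ∀ b → Supp ν b → ∃[ δ ] InComponent D (simple b) δ × Short δ
  component-short {D} ν (acc rec) 0≤ν short Supp⊆D b b∈ν
    with ⟨⟩-pos⇒Supp ν (root ν) 0≤ν (normSq-pos ν)
  ... | a , a∈ν , 0<aν = result
    where
    0<νa′ : 0# < ⟨ root ν , α a ⟩
    0<νa′ = <.<-respʳ-≈ (⟨⟩-sym _ _) 0<aν

    ν′ : Root
    ν′ = reflect ν (simple a)

    ν≡simple : (∀ e → e ≢ a → coeff ν e ≡ 0ℤ) → ν ≡ simple a
    ν≡simple ν≡0 with reduced (simple a) ν (fromℤ (coeff ν a)) (≈ᴹ-trans (expansion ν)
      (combination-single _ α a (λ e e≢a → reflexive (cong fromℤ (ν≡0 e e≢a)))))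
    ... | inj₁ ν≈α  = distinct ν (simple a) ν≈α
    ... | inj₂ ν≈-α = contradiction
      (<.<-respʳ-≈ (≈.trans (⟨⟩-cong ν≈-α ≈ᴹ-refl) (⟨⟩-negˡ _ _)) 0<νa′)
      (<.asym (<.<-respʳ-≈ -0#≈0# (neg-mono-< (normSq-pos (simple a)))))

    module _ {e} (e≢a : e ≢ a) (e∈ν : Supp ν e) where
      0≤ν′ : Positive ν′
      0≤ν′ with oneSigned ν′
      ... | inj₁ 0≤ν′ = 0≤ν′
      ... | inj₂ ν′≤0 = contradiction
        (ℤ.≤-antisym (subst (ℤ._≤ 0ℤ) (coeff-reflect-≢ ν e≢a) (ν′≤0 e)) (0≤ν e)) e∈ν

      Supp⊆D′ : ∀ f → Supp ν′ f → D (simple f)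
      Supp⊆D′ f f∈ν′ with f ≟ a
      ... | yes refl = Supp⊆D a a∈ν
      ... | no f≢a   = Supp⊆D f (f∈ν′ ∘ ≡.trans (coeff-reflect-≢ ν f≢a))

      IH : ∀ f → Supp ν′ f → ∃[ δ ] InComponent D (simple f) δ × Short δ
      IH = component-short ν′ (rec (height-reflect _ ν a 0<νa′ (0≤ν′ a))) 0≤ν′
             (Short-reflect ν (simple a) short) Supp⊆D′

      ν′a<0 : ⟨ root ν′ , α a ⟩ < 0#
      ν′a<0 = <.<-respˡ-≈ (≈.sym (⟨reflect⟩-self ν (simple a)))
                (<.<-respʳ-≈ -0#≈0# (neg-mono-< 0<νa′))

      fromNeighbour : ∃[ δ ] InComponent D (simple a) δ × Short δ
      fromNeighbour =
        let d , d∈ν′ , da<0 = ⟨⟩-neg⇒Supp ν′ (α a) 0≤ν′ ν′a<0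
            δ , path , δ-short = IH d d∈ν′
            a~d = ⟨⟩<0⇒Adjacent {D} (Supp⊆D a a∈ν) (Supp⊆D′ d d∈ν′) (<.<-respˡ-≈ (⟨⟩-sym _ _) da<0)
        in δ , a~d ◅ path , δ-short

    result : ∃[ δ ] InComponent D (simple b) δ × Short δ
    result with any? (λ e → ¬? (e ≟ a) ×-dec ¬? (coeff ν e ℤ.≟ 0ℤ)) | b ≟ a
    ... | yes (_ , e≢a , e∈ν) | yes refl = fromNeighbour e≢a e∈ν
    ... | yes (_ , e≢a , e∈ν) | no b≢a   =
      IH e≢a e∈ν b (b∈ν ∘ ≡.trans (≡.sym (coeff-reflect-≢ ν b≢a)))
    ... | no ∄e | b≟a with ν≡simple (λ e e≢a →
      decidable-stable (coeff ν e ℤ.≟ 0ℤ) (λ e∈ν → ∄e (e , e≢a , e∈ν)))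
    result | no _ | yes refl | ν≡α = simple a , ε , subst Short ν≡α short
    result | no _ | no b≢a   | ν≡α =
      contradiction (≡.trans (cong (λ γ → coeff γ b) ν≡α) (coeff-simple-≢ b≢a)) b∈ν

module MinimumProperties {c ℓ₁ ℓ₂ m ℓm} {K : OrderedField c ℓ₁ ℓ₂}
  {E : EuclideanSpace K m ℓm} {Φ : RootSystem E} (Π : SimpleSystem Φ)
  (S : Subset (SimpleSystem.rank Π)) (β μ : RootSystem.Root Φ)
  (μ-min : SimpleSystem.IsMinimum Π (SimpleSystem.Φ[_,_] Π S β) μ) where
  open OrderedField K hiding (refl; sym; trans; zero)
  open OrderedFieldProperties K
  open EuclideanSpace E
  open EuclideanProperties E
  open RootSystem Φ
  open RootSystemProperties Φ
  open SimpleSystem Π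
  open SimpleSystemProperties Π
  private module ≈ = OrderedField K using (refl; sym; trans)
  open Solver using (solve; _:=_; _:+_; _:*_; :-_; _:-_; con)

  D : Pred Root 0ℓ
  D = [Π∖ S ]∪⁅ μ ⁆

  μ∈Φ : Φ[ S , β ] μ
  μ∈Φ = proj₁ μ-min

  μ-coeff-≤ : ∀ {γ} → Φ[ S , β ] γ → ∀ a → coeff μ a ℤ.≤ coeff γ a
  μ-coeff-≤ γ∈Φ = ≼⇒coeff-≤ (proj₂ μ-min _ γ∈Φ)

  Φ-reflect : ∀ {γ a} → Φ[ S , β ] γ → a ∉ S → Φ[ S , β ] (reflect γ (simple a))
  Φ-reflect {γ} γ∈Φ a∉S b b∈S = ≡.trans (coeff-reflect-≢ γ (λ { refl → a∉S b∈S })) (γ∈Φ b b∈S)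

  μ-obtuse : ∀ {a} → a ∉ S → ⟨ root μ , α a ⟩ ≤ 0#
  μ-obtuse {a} a∉S = ≮⇒≥ λ 0<μa →
    ℤ.<⇒≱ (coeff-reflect-< μ a 0<μa) (μ-coeff-≤ (Φ-reflect μ∈Φ a∉S) a)

  diff-nonneg : ∀ {γ} → Φ[ S , β ] γ → ∀ a → 0# ≤ fromℤ (coeff γ a ℤ.- coeff μ a)
  diff-nonneg γ∈Φ a = fromℤ-mono-≤ (ℤ.i≤j⇒0≤j-i (μ-coeff-≤ γ∈Φ a))

  diff≡0 : ∀ {γ a} → coeff γ a ≡ coeff μ a → fromℤ (coeff γ a ℤ.- coeff μ a) ≈ 0#
  diff≡0 eq = reflexive (cong fromℤ (ℤ.i≡j⇒i-j≡0 eq))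

  Dominated : Pred Root _
  Dominated γ = ∀ a → a ∉ S → ⟨ root γ , α a ⟩ ≤ 0#

  lower : ∀ γ → Acc ℕ._<_ (height (coeff μ) γ) → Φ[ S , β ] γ →
          ∃[ γ′ ] Φ[ S , β ] γ′ × normSq γ′ ≈ normSq γ × Dominated γ′
  lower γ (acc rec) γ∈Φ with any? (λ a → ¬? (a ∈? S) ×-dec (0# <.<? ⟨ root γ , α a ⟩))
  ... | no ∄a = γ , γ∈Φ , ≈.refl , λ a a∉S → ≮⇒≥ (λ 0<γa → ∄a (a , a∉S , 0<γa))
  ... | yes (a , a∉S , 0<γa) =
    let sγ∈Φ = Φ-reflect γ∈Φ a∉S
        γ′ , γ′∈Φ , γ′≈sγ , dom = lower (reflect γ (simple a))
          (rec (height-reflect (coeff μ) γ a 0<γa (μ-coeff-≤ sγ∈Φ a))) sγ∈Φ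
    in γ′ , γ′∈Φ , ≈.trans γ′≈sγ (normSq-reflect γ (simple a)) , dom

  dominated-normSq-≤ : ∀ {γ} → Φ[ S , β ] γ → Dominated γ → normSq γ ≤ ⟨ root γ , root μ ⟩
  dominated-normSq-≤ {γ} γ∈Φ dom = begin
    normSq γ                    ≈⟨ ⟨⟩-expansion-from μ γ (root γ) ⟩
    ⟨ root μ , root γ ⟩ + _     ≤⟨ +-mono-≤ (≤.reflexive (⟨⟩-sym _ _)) (sum-nonpos _ term≤0) ⟩
    ⟨ root γ , root μ ⟩ + 0#    ≈⟨ +-identityʳ _ ⟩
    ⟨ root γ , root μ ⟩         ∎
    where
    open ≤-Reasoning
    term≤0 : ∀ a → fromℤ (coeff γ a ℤ.- coeff μ a) * ⟨ α a , root γ ⟩ ≤ 0#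
    term≤0 a with a ∈? S
    ... | yes a∈S = inj₂
      (≈.trans (*-congʳ (diff≡0 (≡.trans (γ∈Φ a a∈S) (≡.sym (μ∈Φ a a∈S))))) (zeroˡ _))
    ... | no a∉S  = *-nonneg-nonpos (diff-nonneg γ∈Φ a)
                      (≤.trans (≤.reflexive (⟨⟩-sym _ _)) (dom a a∉S))

  Long⇒μ-Long : ∀ {γ} → Φ[ S , β ] γ → Long γ → Long μ
  Long⇒μ-Long {γ} γ∈Φ long =
    let γ′ , γ′∈Φ , γ′≈γ , dom = lower γ (<-wellFounded _) γ∈Φ
    in Long-resp-≤ (≤.trans (≤.reflexive (≈.sym γ′≈γ)) (normSq-≤ (dominated-normSq-≤ γ′∈Φ dom))) long
    where
    -- 0 ≤ ‖γ − μ‖² = ‖γ‖² − 2⟨γ,μ⟩ + ‖μ‖².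
    normSq-≤ : ∀ {γ} → normSq γ ≤ ⟨ root γ , root μ ⟩ → normSq γ ≤ normSq μ
    normSq-≤ {γ} g≤b = begin
      g                              ≈⟨ +-identityˡ g ⟨
      0# + g                         ≤⟨ +-mono-≤ (⟨⟩-nonneg x) g≤b ⟩
      ⟨ x , x ⟩ + b                  ≈⟨ +-congʳ (normSq-sub (root γ) (fromℤ 1ℤ) (root μ)) ⟩
      g - fromℤ 1ℤ * b - fromℤ 1ℤ * (b - fromℤ 1ℤ * n) + b
        ≈⟨ solve 3 (λ g b n → g :- con 1ℤ :* b :- con 1ℤ :* (b :- con 1ℤ :* n) :+ b
                           := g :+ (n :- b)) ≈.refl g b n ⟩
      g + (n - b)                    ≤⟨ +-monoˡ-≤ (n - b) g≤b ⟩
      b + (n - b)                    ≈⟨ solve 2 (λ b n → b :+ (n :- b) := n) ≈.refl b n ⟩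
      n                              ∎
      where
      open ≤-Reasoning
      g = normSq γ
      b = ⟨ root γ , root μ ⟩
      n = normSq μ
      x = root γ +ᴹ -ᴹ (fromℤ 1ℤ *ₗ root μ)

  -- γ = μ + ν for a short root ν in the span of Π∖S with ⟨ν,μ⟩ < 0.
  dominated-Short⇒component-Short : ∀ {γ} → Φ[ S , β ] γ → Short γ → Dominated γ → Long μ →
                                    ∃[ δ ] InComponent D μ δ × Short δ
  dominated-Short⇒component-Short {γ} γ∈Φ γ-short dom μ-long = fromNeighbour
    where
    0<γμ : 0# < ⟨ root γ , root μ ⟩
    0<γμ = begin-strict
      0#                   <⟨ normSq-pos γ ⟩
      normSq γ             ≤⟨ dominated-normSq-≤ γ∈Φ dom ⟩
      ⟨ root γ , root μ ⟩  ∎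
      where open ≤-Reasoning

    cartan≡1 : cartan γ μ ≡ 1ℤ
    cartan≡1 = cartan≡unit γ μ 1ℤ refl (Short∧Long⇒< γ-short μ-long)
      (<.<-respʳ-≈ (≈.sym (≈.trans (*-congʳ fromℤ-1) (*-identityˡ _))) 0<γμ)

    ν : Root
    ν = reflect γ μ

    ν-coeff : ∀ a → coeff ν a ≡ coeff γ a ℤ.- coeff μ a
    ν-coeff a = begin
      coeff ν a                               ≡⟨ coeff-reflect γ μ a ⟩
      coeff γ a ℤ.- cartan γ μ ℤ.* coeff μ a  ≡⟨ cong (λ z → coeff γ a ℤ.- z ℤ.* coeff μ a) cartan≡1 ⟩
      coeff γ a ℤ.- 1ℤ ℤ.* coeff μ a          ≡⟨ cong (λ z → coeff γ a ℤ.- z) (ℤ.*-identityˡ _) ⟩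
      coeff γ a ℤ.- coeff μ a                 ∎
      where open ≡.≡-Reasoning

    0≤ν : Positive ν
    0≤ν a = subst (0ℤ ℤ.≤_) (≡.sym (ν-coeff a)) (ℤ.i≤j⇒0≤j-i (μ-coeff-≤ γ∈Φ a))

    Supp⊆D : ∀ a → Supp ν a → D (simple a)
    Supp⊆D a a∈ν = inj₁ (a , (λ a∈S → a∈ν (≡.trans (ν-coeff a)
      (ℤ.i≡j⇒i-j≡0 (≡.trans (γ∈Φ a a∈S) (≡.sym (μ∈Φ a a∈S)))))) , refl)

    νμ<0 : ⟨ root ν , root μ ⟩ < 0#
    νμ<0 = <.<-respˡ-≈ (≈.sym (⟨reflect⟩-self γ μ)) (<.<-respʳ-≈ -0#≈0# (neg-mono-< 0<γμ))

    fromNeighbour : ∃[ δ ] InComponent D μ δ × Short δ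
    fromNeighbour =
      let b , b∈ν , bμ<0 = ⟨⟩-neg⇒Supp ν (root μ) 0≤ν νμ<0
          δ , path , δ-short = component-short {D} ν (<-wellFounded _) 0≤ν
            (Short-reflect γ μ γ-short) Supp⊆D b b∈ν
          μ~b = ⟨⟩<0⇒Adjacent {D} (inj₂ refl) (Supp⊆D b b∈ν) (<.<-respˡ-≈ (⟨⟩-sym _ _) bμ<0)
      in δ , μ~b ◅ path , δ-short

  Short⇒component-Short : ∀ {γ} → Φ[ S , β ] γ → Short γ → Long μ → ∃[ δ ] InComponent D μ δ × Short δ
  Short⇒component-Short {γ} γ∈Φ γ-short μ-long =
    let γ′ , γ′∈Φ , γ′≈γ , dom = lower γ (<-wellFounded _) γ∈Φ
    in dominated-Short⇒component-Short γ′∈Φ (Short-resp-≤ (≤.reflexive γ′≈γ) γ-short) dom μ-long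

  -- The support of γ ∈ Φ[ S , β ] with respect to the simple system D.
  D-Supp : Root → Pred Root 0ℓ
  D-Supp γ δ = δ ≡ μ ⊎ (∃[ a ] δ ≡ simple a × coeff μ a ℤ.< coeff γ a)

  adjacent-D-Supp⇒⟨⟩<0 : ∀ {γ δ a} → Φ[ S , β ] γ → D-Supp γ δ → a ∉ S →
    coeff γ a ≡ coeff μ a → Adjacent D δ (simple a) → ⟨ root γ , α a ⟩ < 0#
  adjacent-D-Supp⇒⟨⟩<0 {γ} {δ} {a} γ∈Φ δ∈γ a∉S γa≡μa δ~a =
    <.<-respˡ-≈ (≈.sym (⟨⟩-expansion-from μ γ (α a))) (sum<0 δ∈γ δ~a)
    where
    open ≤-Reasoning
    t : Fin rank → Carrier
    t b = fromℤ (coeff γ b ℤ.- coeff μ b) * ⟨ α b , α a ⟩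
    t≤0 : ∀ b → t b ≤ 0#
    t≤0 b with b ≟ a
    ... | yes refl = inj₂ (≈.trans (*-congʳ (diff≡0 γa≡μa)) (zeroˡ _))
    ... | no b≢a   = *-nonneg-nonpos (diff-nonneg γ∈Φ b) (simple-obtuse b≢a)
    sum<0 : D-Supp γ δ → Adjacent D δ (simple a) → ⟨ root μ , α a ⟩ + sum t < 0#
    sum<0 (inj₁ refl) μ~a = begin-strict
      ⟨ root μ , α a ⟩ + sum t  <⟨ +-monoˡ-< _ (Adjacent⇒⟨⟩<0 {D} (μ-obtuse a∉S) μ~a) ⟩
      0# + sum t                ≈⟨ +-identityˡ _ ⟩
      sum t                     ≤⟨ sum-nonpos t t≤0 ⟩
      0#                        ∎
    sum<0 (inj₂ (b , refl , μb<γb)) b~a@(_ , _ , b≢a , _) = begin-strict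
      ⟨ root μ , α a ⟩ + sum t  ≤⟨ +-monoˡ-≤ _ (μ-obtuse a∉S) ⟩
      0# + sum t                ≈⟨ +-identityˡ _ ⟩
      sum t                     <⟨ sum-neg t t≤0 b (*-pos-neg
                                     (fromℤ-mono-< (i<j⇒0<j-i μb<γb))
                                     (Adjacent⇒⟨⟩<0 {D} (simple-obtuse (b≢a ∘ cong simple)) b~a)) ⟩
      0#                        ∎

  -- Along the path δ, γ grows so that its D-support contains δ. While γ and its
  -- support stay long, a short neighbour is absorbed into a short member of Φ[ S , β ].
  component-Short⇒Short : ∀ {δ η} → InComponent D δ η → Short η → ∀ γ → Φ[ S , β ] γ → Long γ →
    (∀ θ → D-Supp γ θ → Long θ) → D-Supp γ δ → ∃[ γ′ ] Φ[ S , β ] γ′ × Short γ′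
  component-Short⇒Short ε short γ _ _ supp-long δ∈γ =
    contradiction (supp-long _ δ∈γ) (Short⇒¬Long short)
  component-Short⇒Short ((_ , inj₂ refl , _) ◅ path) short γ γ∈Φ long supp-long _ =
    component-Short⇒Short path short γ γ∈Φ long supp-long (inj₁ refl)
  component-Short⇒Short (δ~a@(_ , inj₁ (a , a∉S , refl) , _) ◅ path) short γ γ∈Φ long supp-long δ∈γ
    with coeff μ a ℤ.<? coeff γ a
  ... | yes μa<γa = component-Short⇒Short path short γ γ∈Φ long supp-long (inj₂ (a , refl , μa<γa))
  ... | no μa≮γa = extend (Long⊎Short (simple a))
    where
    γa≡μa : coeff γ a ≡ coeff μ a
    γa≡μa = ℤ.≤-antisym (ℤ.≮⇒≥ μa≮γa) (μ-coeff-≤ γ∈Φ a)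

    γa<0 : ⟨ root γ , α a ⟩ < 0#
    γa<0 = adjacent-D-Supp⇒⟨⟩<0 γ∈Φ δ∈γ a∉S γa≡μa δ~a

    γ′ : Root
    γ′ = reflect γ (simple a)

    μa<γ′a : coeff μ a ℤ.< coeff γ′ a
    μa<γ′a = subst (ℤ._< coeff γ′ a) γa≡μa (coeff-reflect-> γ a γa<0)

    module _ (a-long : Long (simple a)) where
      γ′-supp-long : ∀ θ → D-Supp γ′ θ → Long θ
      γ′-supp-long θ (inj₁ θ≡μ) = supp-long θ (inj₁ θ≡μ)
      γ′-supp-long θ (inj₂ (b , refl , μb<γ′b)) with b ≟ a
      ... | yes refl = a-long
      ... | no b≢a   = supp-long θ
        (inj₂ (b , refl , subst (coeff μ b ℤ.<_) (coeff-reflect-≢ γ b≢a) μb<γ′b))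

    module _ (a-short : Short (simple a)) where
      cartan≡-1 : cartan (simple a) γ ≡ -1ℤ
      cartan≡-1 = cartan≡unit (simple a) γ -1ℤ refl (Short∧Long⇒< a-short long) (begin-strict
        0#                              ≈⟨ -0#≈0# ⟨
        - 0#                            <⟨ neg-mono-< γa<0 ⟩
        - ⟨ root γ , α a ⟩              ≈⟨ solve 1 (λ x → :- x := con -1ℤ :* x) ≈.refl _ ⟩
        fromℤ -1ℤ * ⟨ root γ , α a ⟩    ≈⟨ *-congˡ (⟨⟩-sym _ _) ⟩
        fromℤ -1ℤ * ⟨ α a , root γ ⟩    ∎)
        where open ≤-Reasoning

      sum∈Φ : Φ[ S , β ] (reflect (simple a) γ)
      sum∈Φ b b∈S = begin
        coeff (reflect (simple a) γ) b
          ≡⟨ coeff-reflect (simple a) γ b ⟩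
        coeff (simple a) b ℤ.- cartan (simple a) γ ℤ.* coeff γ b
          ≡⟨ cong₂ (λ x z → x ℤ.- z ℤ.* coeff γ b) (coeff-simple-≢ (λ { refl → a∉S b∈S })) cartan≡-1 ⟩
        0ℤ ℤ.- -1ℤ ℤ.* coeff γ b
          ≡⟨ 0--1*x≡x (coeff γ b) ⟩
        coeff γ b
          ≡⟨ γ∈Φ b b∈S ⟩
        coeff β b ∎
        where
        open ≡.≡-Reasoning
        0--1*x≡x : ∀ x → 0ℤ ℤ.- -1ℤ ℤ.* x ≡ x
        0--1*x≡x = ℤ-RingSolver.solve-∀

    extend : Long (simple a) ⊎ Short (simple a) → ∃[ γ″ ] Φ[ S , β ] γ″ × Short γ″
    extend (inj₂ a-short) = reflect (simple a) γ , sum∈Φ a-short , Short-reflect (simple a) γ a-short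
    extend (inj₁ a-long)  = component-Short⇒Short path short γ′ (Φ-reflect γ∈Φ a∉S)
      (Long-reflect γ (simple a) long) (γ′-supp-long a-long) (inj₂ (a , refl , μa<γ′a))

  μ-component-Short⇒Short : ∀ {η} → Long μ → InComponent D μ η → Short η →
                            ∃[ γ ] Φ[ S , β ] γ × Short γ
  μ-component-Short⇒Short μ-long path short = component-Short⇒Short path short μ μ∈Φ μ-long
    (λ { θ (inj₁ refl) → μ-long ; θ (inj₂ (_ , _ , μa<μa)) → contradiction μa<μa (ℤ.<-irrefl refl) })
    (inj₁ refl)

proposition4p12 : ∀ {c ℓ₁ ℓ₂ m ℓm} {K : OrderedField c ℓ₁ ℓ₂} {E : EuclideanSpace K m ℓm}
    (Φ : RootSystem E) (Π : SimpleSystem Φ) →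
    let open RootSystem Φ
        open SimpleSystem Π
    in
    Irreducible →
    (S : Subset rank) (β : Root) → Positive β → (∃[ a ] a ∈ S × Supp β a) →
    (μ : Root) → IsMinimum Φ[ S , β ] μ →
    ((∀ γ → Φ[ S , β ] γ → Short γ) ⇔ Short μ)
    ×
    ((∀ γ → Φ[ S , β ] γ → Long γ) ⇔
      (Long μ × (∀ α → InComponent [Π∖ S ]∪⁅ μ ⁆ μ α → Long α)))
    ×
    (((∃[ γ ] Φ[ S , β ] γ × Long γ) × (∃[ γ ] Φ[ S , β ] γ × Short γ)) ⇔
      (Long μ × (∃[ α ] InComponent [Π∖ S ]∪⁅ μ ⁆ μ α × Short α)))
proposition4p12 Φ Π _ S β _ _ μ μ-min = part1 , part2 , part3
  where
  open RootSystem Φ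
  open RootSystemProperties Φ
  open SimpleSystem Π
  open MinimumProperties Π S β μ μ-min

  part1 : (∀ γ → Φ[ S , β ] γ → Short γ) ⇔ Short μ
  part1 = mk⇔ (λ all-short → all-short μ μ∈Φ) λ μ-short γ γ∈Φ →
    [ (λ γ-long → contradiction (Long⇒μ-Long γ∈Φ γ-long) (Short⇒¬Long μ-short)) , id ]′ (Long⊎Short γ)

  part2 : (∀ γ → Φ[ S , β ] γ → Long γ) ⇔
          (Long μ × (∀ α → InComponent [Π∖ S ]∪⁅ μ ⁆ μ α → Long α))
  part2 = mk⇔
    (λ all-long → all-long μ μ∈Φ , λ α path →
      [ id
      , (λ α-short →
          let γ , γ∈Φ , γ-short = μ-component-Short⇒Short (all-long μ μ∈Φ) path α-short
          in contradiction (all-long γ γ∈Φ) (Short⇒¬Long γ-short)) ]′ (Long⊎Short α))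
    (λ (μ-long , component-long) γ γ∈Φ →
      [ id
      , (λ γ-short →
          let α , path , α-short = Short⇒component-Short γ∈Φ γ-short μ-long
          in contradiction (component-long α path) (Short⇒¬Long α-short)) ]′ (Long⊎Short γ))

  part3 : ((∃[ γ ] Φ[ S , β ] γ × Long γ) × (∃[ γ ] Φ[ S , β ] γ × Short γ)) ⇔
          (Long μ × (∃[ α ] InComponent [Π∖ S ]∪⁅ μ ⁆ μ α × Short α))
  part3 = mk⇔
    (λ { ((_ , γ∈Φ , γ-long) , (_ , δ∈Φ , δ-short)) →
      let μ-long = Long⇒μ-Long γ∈Φ γ-long
      in μ-long , Short⇒component-Short δ∈Φ δ-short μ-long })
    (λ { (μ-long , _ , path , α-short) →
      (μ , μ∈Φ , μ-long) , μ-component-Short⇒Short μ-long path α-short })
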